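{- Let $G$ be the line graph of a constant-multiplicity multigraph. Then $G$ contains a totally odd strong immersion of the complete graph $K_{\chi(G)}$, where $\chi(G)$ denotes the chromatic number of $G$.
   Context: Graphs are finite, loopless and simple; multigraphs are finite and loopless but may have parallel edges. A multigraph has constant multiplicity if there is an integer $m\ge 1$ such that every two adjacent vertices are joined by exactly $m$ parallel edges (equivalently, it is obtained from a simple graph by replacing each edge with $m$ parallel edges). The line graph $L(H)$ of a multigraph $H$ is the simple graph whose vertices are the edges of $H$, where two distinct edges of $H$ are adjacent in $L(H)$ if they share at least one endpoint (so parallel edges are adjacent). A graph $G$ contains a graph $H$ as an immersion if there is an injective function $\phi\colon V(H)\to V(G)$ such that: (I) for every $uv\in E(H)$ there is a path $P_{uv}$ in $G$ with endpoints $\phi(u)$ and $\phi(v)$; and (II) the paths in $\{P_{uv}\mid uv\in E(H)\}$ are pairwise edge-disjoint. The vertices in $\phi(V(H))$ are the terminals of the immersion. The immersion is strong if no terminal appears as an interior vertex of any path $P_{uv}$. An immersion (or strong immersion) is totally odd if every path $P_{uv}$ is odd, i.e. has an odd number of edges. -}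

module Defs where

open import Data.Empty using (⊥-elim)
open import Data.Fin using (Fin; _<_; finToFun; funToFin)
open import Data.Fin.Properties using (_≟_; any?; all?; finToFun-funToFin)
open import Data.List using (List; []; _∷_; length; filter; allFin)
open import Data.List.Membership.Propositional using (_∈_)
open import Data.List.Relation.Unary.Unique.Propositional using (Unique)
open import Data.Nat using (ℕ; zero; suc; _≤_; _^_; z≤n; s≤s; parity)
open import Data.Parity using (1ℙ)
open import Data.Product using (Σ; ∃; _×_; _,_; proj₁; proj₂; swap)
open import Data.Product.Properties using (≡-dec)
open import Data.Sum using (_⊎_)
open import Function using (_∘_; id; Injective)
open import Relation.Binary using (Rel; Symmetric; Irreflexive; Decidable)
open import Relation.Binary.Construct.Closure.ReflexiveTransitive using (Star; ε; _◅_)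
open import Relation.Binary.PropositionalEquality
  using (_≡_; _≢_; refl; sym; trans; ≢-sym)
open import Relation.Nullary using (¬_; Dec; yes; no; ¬?)
open import Relation.Nullary.Decidable using (_×-dec_; _⊎-dec_; _→-dec_; map′)
open import Level using (0ℓ)

record Graph : Set₁ where
  field
    order      : ℕ
    Adj        : Rel (Fin order) 0ℓ
    adj?       : Decidable Adj
    adj-sym    : Symmetric Adj
    adj-irrefl : Irreflexive _≡_ Adj

  Vertex : Set
  Vertex = Fin order

  -- An undirected edge is listed once, with its smaller endpoint first.  The
  -- proofs are irrelevant, so an edge is determined by its endpoints.
  record Edge : Set where
    constructor edge
    field
      src tgt  : Vertex
      .src<tgt : src < tgt
      .adj     : Adj src tgt

complete : ℕ → Graph
complete n = record
  { order      = n
  ; Adj        = _≢_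
  ; adj?       = λ u v → ¬? (u ≟ v)
  ; adj-sym    = ≢-sym
  ; adj-irrefl = λ u≡v u≢v → u≢v u≡v
  }

module _ (G : Graph) where
  open Graph G

  IsColouring : ∀ {k} → (Vertex → Fin k) → Set
  IsColouring c = ∀ u v → Adj u v → c u ≢ c v

  Colourable : ℕ → Set
  Colourable k = Σ (Vertex → Fin k) IsColouring

  IsChromaticNumber : ℕ → Set
  IsChromaticNumber k = Colourable k × (∀ j → Colourable j → k ≤ j)

  private
    isColouring? : ∀ {k} (c : Vertex → Fin k) → Dec (IsColouring c)
    isColouring? c =
      all? λ u → all? λ v → adj? u v →-dec ¬? (c u ≟ c v)

    colourable? : ∀ k → Dec (Colourable k)
    colourable? k = map′ (λ (i , p) → finToFun i , p) encode
                         (any? {n = k ^ order} (λ i → isColouring? (finToFun i)))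
      where
      encode : Colourable k → ∃ λ (i : Fin (k ^ order)) → IsColouring (finToFun i)
      encode (c , p) = funToFin c , λ u v a e → p u v a
        (trans (sym (finToFun-funToFin c u)) (trans e (finToFun-funToFin c v)))

    least : (P : ℕ → Set) → (∀ k → Dec (P k)) → ∀ n → P n →
            ∃ λ k → P k × (∀ j → P j → k ≤ j)
    least P P? n pn with P? zero
    ... | yes p0 = zero , p0 , λ _ _ → z≤n
    least P P? zero    pn | no ¬p0 = ⊥-elim (¬p0 pn)
    least P P? (suc n) pn | no ¬p0 =
      let k , pk , min = least (P ∘ suc) (P? ∘ suc) n pn in
      suc k , pk , λ { zero p0 → ⊥-elim (¬p0 p0) ; (suc j) pj → s≤s (min j pj) }

  chromaticNumber : ∃ IsChromaticNumber
  chromaticNumber =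
    least Colourable colourable? order (id , λ _ _ a u≡v → adj-irrefl u≡v a)

  χ : ℕ
  χ = proj₁ chromaticNumber

-- Parallel edges are distinct indices with the same endpoints; the order of
-- the two components of `ends e` carries no meaning.
record Multigraph : Set where
  field
    order    : ℕ
    size     : ℕ
    ends     : Fin size → Fin order × Fin order
    loopless : ∀ e → proj₁ (ends e) ≢ proj₂ (ends e)

  Joins : Fin order → Fin order → Fin size → Set
  Joins u v e = ends e ≡ (u , v) ⊎ ends e ≡ (v , u)

  joins? : ∀ u v e → Dec (Joins u v e)
  joins? u v e = ≡-dec _≟_ _≟_ (ends e) (u , v) ⊎-dec ≡-dec _≟_ _≟_ (ends e) (v , u)

  Adjacent : Rel (Fin order) 0ℓ
  Adjacent u v = ∃ (Joins u v)

  multiplicity : Fin order → Fin order → ℕ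
  multiplicity u v = length (filter (joins? u v) (allFin size))

  Incident : Fin order → Fin size → Set
  Incident v e = v ≡ proj₁ (ends e) ⊎ v ≡ proj₂ (ends e)

  incident? : ∀ v e → Dec (Incident v e)
  incident? v e = (v ≟ proj₁ (ends e)) ⊎-dec (v ≟ proj₂ (ends e))

ConstantMultiplicity : Multigraph → Set
ConstantMultiplicity H =
  ∃ λ m → 1 ≤ m × (∀ u v → Adjacent u v → multiplicity u v ≡ m)
  where open Multigraph H

lineGraph : Multigraph → Graph
lineGraph H = record
  { order      = size
  ; Adj        = λ e f → e ≢ f × ∃ λ v → Incident v e × Incident v f
  ; adj?       = λ e f → ¬? (e ≟ f) ×-dec any? (λ v → incident? v e ×-dec incident? v f)
  ; adj-sym    = λ (e≢f , v , ie , if) → ≢-sym e≢f , v , if , ie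
  ; adj-irrefl = λ e≡f (e≢f , _) → e≢f e≡f
  }
  where open Multigraph H

module _ {G : Graph} where
  open Graph G

  vertices : ∀ {u v} → Star Adj u v → List Vertex
  vertices {u} ε       = u ∷ []
  vertices {u} (_ ◅ w) = u ∷ vertices w

  steps : ∀ {u v} → Star Adj u v → List (Vertex × Vertex)
  steps ε                 = []
  steps (_◅_ {u} {v} _ w) = (u , v) ∷ steps w

record Path (G : Graph) (u v : Graph.Vertex G) : Set where
  open Graph G
  field
    walk     : Star Adj u v
    distinct : Unique (vertices {G} walk)

  len : ℕ
  len = length (steps {G} walk)

  Traverses : Vertex × Vertex → Set
  Traverses xy = xy ∈ steps {G} walk ⊎ swap xy ∈ steps {G} walk

  Interior : Vertex → Set
  Interior x = x ∈ vertices {G} walk × x ≢ u × x ≢ v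

EdgeDisjoint : ∀ {G u v u′ v′} → Path G u v → Path G u′ v′ → Set
EdgeDisjoint P Q = ∀ xy → ¬ (Path.Traverses P xy × Path.Traverses Q xy)

record Immersion (H G : Graph) : Set where
  open Graph using (Vertex; Edge)
  open Graph.Edge using (src; tgt)
  field
    φ             : Vertex H → Vertex G
    φ-injective   : Injective _≡_ _≡_ φ
    path          : (e : Edge H) → Path G (φ (src e)) (φ (tgt e))
    edge-disjoint : ∀ e f → e ≢ f → EdgeDisjoint (path e) (path f)

  Strong : Set
  Strong = ∀ w e → ¬ Path.Interior (path e) (φ w)

  TotallyOdd : Set
  TotallyOdd = ∀ e → parity (Path.len (path e)) ≡ 1ℙ

ContainsTotallyOddStrongImmersion : Graph → Graph → Set
ContainsTotallyOddStrongImmersion G H =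
  Σ (Immersion H G) λ I → Immersion.Strong I × Immersion.TotallyOdd I

{-# OPTIONS --safe #-}

-- Let D be a simple graph that contains one edge of each parallel class of H, and let t be the
-- chromatic number of L(D).  Colouring the copies of an edge with m private colours each gives
-- χ(L(H)) ≤ tm.  Conversely, from a totally odd strong immersion of K_t in L(D) one of K_tm in
-- L(H) is obtained by replacing each edge with its m copies: as a path x₀ … x₂ₖ₊₁ has odd
-- length, its alternating lifts x₀ᵃ x₁ᵇ x₂ᵃ … x₂ₖ₊₁ᵇ join all pairs of copies of its ends.
--
-- If a vertex of D has degree at least t, its edges are a clique.  Otherwise, with d = t − 1, D has
-- maximum degree at most d and is not d-edge-colourable; pass to a critical subgraph.  If an edge
-- has at most d neighbours in L(D), it is joined to them and Kempe chains join any two of them.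
-- Otherwise use Vizing's fans: every neighbour of a vertex has a further neighbour of degree d.
-- By uncrossing, among the minimum cuts between two vertices of degree d some cut has only one
-- such vertex x on one side, so it has at least d edges; by Menger's theorem the d edges at x are
-- linked in L(D) to the d edges at some y by disjoint paths.  The edges at y and one edge f at x,
-- which is adjacent to the starts of all these paths, are the terminals.
module Submission where

open import Defs
open import Algebra.Properties.CommutativeSemigroup using (interchange)
open import Data.Bool using (Bool; true; false; _∧_; _∨_; _xor_; T; if_then_else_)
open import Data.Bool.Properties using (T?)
open import Data.Empty using (⊥; ⊥-elim)
open import Data.Fin as Fin using (Fin; zero; suc)
open import Data.Fin.Permutation.Components using (transpose; transpose-inverse)
import Data.Fin.Properties as Fin
open import Data.Fin.Subset as Subset using (Subset; _-_; _∩_; _∪_; ∁; ⁅_⁆; ∣_∣)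
  renaming (_∈_ to _∈ˢ_; _∉_ to _∉ˢ_; _⊆_ to _⊆ˢ_)
open import Data.Fin.Subset.Properties as Subset
  using (anySubset?; p─q⊆p; x∈p∧x≢y⇒x∈p-y; x∈p⇒∣p-x∣<∣p∣) renaming (_∈?_ to _∈ˢ?_)
open import Data.List
  using (List; []; _∷_; allFin; cartesianProduct; deduplicate; filter; length; lookup)
import Data.List.Properties as List
open import Data.List.Membership.Propositional using (_∈_; _∉_)
open import Data.List.Membership.Propositional.Properties
  using (∈-allFin; ∈-cartesianProduct⁺; ∈-deduplicate⁺; ∈-deduplicate⁻; ∈-filter⁺; ∈-filter⁻;
         ∈-lookup)
import Data.List.Membership.DecPropositional as DecMembership
import Data.List.Membership.Setoid.Properties as SetoidMembership
open import Data.List.Relation.Binary.Subset.Propositional using (_⊆_)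
open import Data.List.Relation.Unary.All as All using (All; []; _∷_)
open import Data.List.Relation.Unary.AllPairs using ([]; _∷_)
open import Data.List.Relation.Unary.Any as Any using (Any; here; there)
import Data.List.Relation.Unary.Any.Properties as Any
open import Data.List.Relation.Unary.Unique.Propositional using (Unique)
import Data.List.Relation.Unary.Unique.Propositional.Properties as Unique
import Data.List.Relation.Unary.Unique.DecPropositional.Properties as DecUnique
open import Data.Nat as ℕ using (ℕ; zero; suc; parity; z≤n; s≤s)
import Data.Nat.Properties as ℕ
open import Data.Parity using (Parity; 0ℙ; 1ℙ; _⁻¹)
import Data.Parity.Properties as Parity
open import Data.Product using (Σ; ∃; ∃₂; _×_; _,_; proj₁; proj₂)
open import Data.Product.Properties using (,-injective)
open import Data.Sum using (_⊎_; inj₁; inj₂; [_,_]′)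
open import Data.Unit using (tt)
import Data.Vec as Vec
import Data.Vec.Properties as Vec
open import Function using (_∘_; id; Injective)
open import Level using (0ℓ)
open import Relation.Binary using (Rel; Decidable; DecidableEquality; tri<; tri≈; tri>)
open import Relation.Binary.Construct.Closure.ReflexiveTransitive as Star using (Star; ε; _◅_; _◅◅_)
open import Relation.Binary.PropositionalEquality
  using (_≡_; _≢_; refl; sym; trans; cong; cong₂; subst; subst₂; setoid)
open import Relation.Nullary using (¬_; Dec; yes; no; contradiction)
open import Relation.Nullary.Decidable
  using (¬?; _×-dec_; _⊎-dec_; _→-dec_; dec-false; dec-true; decidable-stable; map′; recompute)

-- Menger's theorem gives no control over the parity of the linking paths, and this shapes the
-- argument. If an edge `b` at `y` has more than d neighbours in the line graph, at most d - 1 of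
-- them are at `y`, so at least two lie at its other end. These are adjacent to each other and to
-- `b`, so a path that enters `b` from there can be made longer by one step. If some edge has at
-- most d neighbours, this room may be missing, but then criticality makes its neighbours carry each
-- of d colours exactly once, and Kempe chains between them are odd because colours alternate. A cut
-- with a single vertex of degree d on one side is sought because only there does Vizing's adjacency
-- lemma bound the cut: each edge at that vertex can be charged to a cut edge of its own.
-- Edge-disjointness is never checked path against path: a symmetric relation on steps is reserved
-- for each pair of terminals, and a step determines the pair that owns it.

-- Lists and the pigeonhole principle

module _ {A : Set} where

  lookup-unique : ∀ {xs : List A} → Unique xs → Injective _≡_ _≡_ (lookup xs)
  lookup-unique (x∉ ∷ u) {zero} {zero} e = refl
  lookup-unique (x∉ ∷ u) {zero} {suc j} e = contradiction e (All.lookup x∉ (∈-lookup j))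
  lookup-unique (x∉ ∷ u) {suc i} {zero} e = contradiction (sym e) (All.lookup x∉ (∈-lookup i))
  lookup-unique (x∉ ∷ u) {suc i} {suc j} e = cong suc (lookup-unique u e)

  injection-length : ∀ {k} {f : Fin k → A} {xs} → Injective _≡_ _≡_ f →
                     (∀ i → f i ∈ xs) → k ℕ.≤ length xs
  injection-length f-inj f∈ = Fin.injective⇒≤ λ {i} {j} e →
    f-inj (SetoidMembership.index-injective (setoid A) (f∈ i) (f∈ j) e)

  unique-⊆-length : ∀ {xs ys : List A} → Unique xs → xs ⊆ ys → length xs ℕ.≤ length ys
  unique-⊆-length u xs⊆ys = injection-length (lookup-unique u) (xs⊆ys ∘ ∈-lookup)

  -- A missed element would extend `f` to an injection of k + 1 elements into a list of length at
  -- most k.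
  injection-covers : DecidableEquality A → ∀ {k} {f : Fin k → A} {xs} → Injective _≡_ _≡_ f →
                     (∀ i → f i ∈ xs) → length xs ℕ.≤ k → ∀ {x} → x ∈ xs → ∃ λ i → f i ≡ x
  injection-covers _≟_ {k} {f} {xs} f-inj f∈ xs≤k {x} x∈ with Fin.any? (λ i → f i ≟ x)
  ... | yes found = found
  ... | no ¬found = contradiction xs≤k (ℕ.<⇒≱ (injection-length g-inj g∈))
    where
    g : Fin (suc k) → A
    g zero = x
    g (suc i) = f i
    g-inj : Injective _≡_ _≡_ g
    g-inj {zero} {zero} _ = refl
    g-inj {zero} {suc j} e = contradiction (j , sym e) ¬found
    g-inj {suc i} {zero} e = contradiction (i , e) ¬found
    g-inj {suc i} {suc j} e = cong suc (f-inj e)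
    g∈ : ∀ i → g i ∈ xs
    g∈ zero = x∈
    g∈ (suc i) = f∈ i

  ∉⇒All≢ : ∀ {x : A} {xs} → x ∉ xs → All (x ≢_) xs
  ∉⇒All≢ x∉ = All.tabulate λ y∈ x≡y → x∉ (subst (_∈ _) (sym x≡y) y∈)

  unique-head : ∀ {x : A} {xs} → Unique (x ∷ xs) → x ∉ xs
  unique-head (x≢ ∷ _) x∈ = All.lookup x≢ x∈ refl

-- Walks

module _ {A : Set} {R : Rel A 0ℓ} where

  -- The counterpart of `vertices` for an arbitrary relation, so that Menger's walks, Kempe chains
  -- and lifted paths share the same lemmas.
  support : ∀ {u v} → Star R u v → List A
  support {u} ε       = u ∷ []
  support {u} (_ ◅ w) = u ∷ support w

  arcs : ∀ {u v} → Star R u v → List (A × A)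
  arcs ε                 = []
  arcs (_◅_ {u} {v} _ w) = (u , v) ∷ arcs w

  start∈support : ∀ {u v} (w : Star R u v) → u ∈ support w
  start∈support ε       = here refl
  start∈support (_ ◅ _) = here refl

  end∈support : ∀ {u v} (w : Star R u v) → v ∈ support w
  end∈support ε       = here refl
  end∈support (_ ◅ w) = there (end∈support w)

  support-◅◅ : ∀ {u v t x} (w : Star R u v) (w′ : Star R v t) →
               x ∈ support (w ◅◅ w′) → x ∈ support w ⊎ x ∈ support w′
  support-◅◅ ε        w′ x∈          = inj₂ x∈
  support-◅◅ (_ ◅ w) w′ (here refl) = inj₁ (here refl)
  support-◅◅ (_ ◅ w) w′ (there x∈) with support-◅◅ w w′ x∈
  ... | inj₁ x∈w  = inj₁ (there x∈w)
  ... | inj₂ x∈w′ = inj₂ x∈w′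

  unique-◅◅ : ∀ {u v t} (w : Star R u v) (w′ : Star R v t) →
              Unique (support w) → Unique (support w′) →
              (∀ {x} → x ∈ support w → x ∈ support w′ → x ≡ v) → Unique (support (w ◅◅ w′))
  unique-◅◅ ε w′ _ U′ _ = U′
  unique-◅◅ {u} (_ ◅ w) w′ U@(_ ∷ U₁) U′ meet =
    ∉⇒All≢ u∉ ∷ unique-◅◅ w w′ U₁ U′ (meet ∘ there)
    where
    u∉ : u ∉ support (w ◅◅ w′)
    u∉ u∈ with support-◅◅ w w′ u∈
    ... | inj₁ u∈w = unique-head U u∈w
    ... | inj₂ u∈w′ with refl ← meet (here refl) u∈w′ = unique-head U (end∈support w)

  arcs-related : ∀ {u v x y} (w : Star R u v) → (x , y) ∈ arcs w → R x y
  arcs-related (r ◅ _) (here refl) = r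
  arcs-related (_ ◅ w) (there xy∈) = arcs-related w xy∈

  arcs-support : ∀ {u v x y} (w : Star R u v) → (x , y) ∈ arcs w → x ∈ support w × y ∈ support w
  arcs-support (_ ◅ w) (here refl) = here refl , there (start∈support w)
  arcs-support (_ ◅ w) (there xy∈) = let x∈ , y∈ = arcs-support w xy∈ in there x∈ , there y∈

  arcs-◅◅ : ∀ {u v t xy} (w : Star R u v) (w′ : Star R v t) →
            xy ∈ arcs (w ◅◅ w′) → xy ∈ arcs w ⊎ xy ∈ arcs w′
  arcs-◅◅ ε        w′ xy∈         = inj₂ xy∈
  arcs-◅◅ (_ ◅ w) w′ (here refl) = inj₁ (here refl)
  arcs-◅◅ (_ ◅ w) w′ (there xy∈) with arcs-◅◅ w w′ xy∈
  ... | inj₁ xy∈w  = inj₁ (there xy∈w)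
  ... | inj₂ xy∈w′ = inj₂ xy∈w′

  length-arcs-◅◅ : ∀ {u v t} (w : Star R u v) (w′ : Star R v t) →
                   length (arcs (w ◅◅ w′)) ≡ length (arcs w) ℕ.+ length (arcs w′)
  length-arcs-◅◅ ε        w′ = refl
  length-arcs-◅◅ (_ ◅ w) w′ = cong suc (length-arcs-◅◅ w w′)

  closed-walk-empty : ∀ {u v} (w : Star R u v) → Unique (support w) → u ≡ v → length (arcs w) ≡ 0
  closed-walk-empty ε       _ _    = refl
  closed-walk-empty (_ ◅ w) U refl = contradiction (end∈support w) (unique-head U)

  -- The last component says that a proper initial segment of a simple walk misses the end of the
  -- walk. `suffix` has the mirror image, and `crossing` needs both.
  prefix : ∀ {u v x} (w : Star R u v) → x ∈ support w → ∃ λ (w₁ : Star R u x) →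
           support w₁ ⊆ support w × (Unique (support w) → v ∈ support w₁ → x ≡ v)
  prefix ε       (here refl) = ε , id , λ _ _ → refl
  prefix (_ ◅ w) (here refl) = ε , (λ { (here refl) → here refl }) , λ { _ (here refl) → refl }
  prefix (r ◅ w) (there x∈) =
    let w₁ , w₁⊆w , only = prefix w x∈ in
    r ◅ w₁ , (λ { (here refl) → here refl ; (there y∈) → there (w₁⊆w y∈) }) ,
    λ { U (here refl)      → contradiction (end∈support w) (unique-head U)
      ; (_ ∷ U) (there v∈) → only U v∈ }

  suffix : ∀ {u v x} (w : Star R u v) → x ∈ support w → ∃ λ (w₂ : Star R x v) →
           support w₂ ⊆ support w × (Unique (support w) → Unique (support w₂)) ×
           (Unique (support w) → u ∈ support w₂ → x ≡ u)
  suffix ε         (here refl) = ε , id , id , λ _ _ → refl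
  suffix w@(_ ◅ _) (here refl) = w , id , id , λ _ _ → refl
  suffix (r ◅ w)   (there x∈) =
    let w₂ , w₂⊆w , uniq , _ = suffix w x∈ in
    w₂ , there ∘ w₂⊆w , (λ { (_ ∷ U) → uniq U }) ,
    λ U u∈ → contradiction (w₂⊆w u∈) (unique-head U)

  simplify : DecidableEquality A → ∀ {u v} → Star R u v → ∃ λ (w : Star R u v) → Unique (support w)
  simplify _≟_ ε = ε , [] ∷ []
  simplify _≟_ {u} (r ◅ w) with simplify _≟_ w
  ... | w′ , U with Any.any? (u ≟_) (support w′)
  ... | yes u∈ = let w₂ , _ , uniq , _ = suffix w′ u∈ in w₂ , uniq U
  ... | no  u∉ = r ◅ w′ , ∉⇒All≢ u∉ ∷ U

  -- Used to stop a spoke at its first edge at the tip; a second edge at the tip is then certain to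
  -- be off the walk.
  first-hit : ∀ {P : A → Set} → (∀ x → Dec (P x)) → ∀ {u v} (w : Star R u v) →
              Unique (support w) → ¬ P v → ∀ {x} → x ∈ support w → P x →
              ∃ λ q → P q × ∃ λ (w₁ : Star R u q) → Unique (support w₁) × support w₁ ⊆ support w ×
              v ∉ support w₁ × (∀ {y} → y ∈ support w₁ → P y → y ≡ q)
  first-hit P? {u} w U ¬Pv x∈ Px with P? u
  first-hit P? {u} {v} w U ¬Pv x∈ Px | yes Pu =
    u , Pu , ε , [] ∷ [] , (λ { (here refl) → start∈support w }) ,
    (λ { (here refl) → ¬Pv Pu }) , λ { (here refl) _ → refl }
  first-hit P? ε U ¬Pv (here refl) Px | no ¬Pu = contradiction Px ¬Pu
  first-hit P? (r ◅ w) U ¬Pv (here refl) Px | no ¬Pu = contradiction Px ¬Pu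
  first-hit P? (r ◅ w) U@(_ ∷ U₁) ¬Pv (there x∈) Px | no ¬Pu =
    let q , Pq , w₁ , V , w₁⊆w , v∉ , only = first-hit P? w U₁ ¬Pv x∈ Px in
    q , Pq , r ◅ w₁ , ∉⇒All≢ (unique-head U ∘ w₁⊆w) ∷ V ,
    (λ { (here refl) → here refl ; (there y∈) → there (w₁⊆w y∈) }) ,
    (λ { (here refl) → unique-head U (end∈support w) ; (there v∈) → v∉ v∈ }) ,
    λ { (here refl) Pu → contradiction Pu ¬Pu ; (there y∈) → only y∈ }

  last-step : ∀ {u v} (w : Star R u v) → u ≢ v → ∃ λ p → p ∈ support w × R p v
  last-step ε u≢u = contradiction refl u≢u
  last-step {u} (r ◅ ε) _ = u , here refl , r
  last-step (r ◅ w@(s ◅ w′)) _ with last-step′ s w′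
    where
    last-step′ : ∀ {u t v} (s : R u t) (w : Star R t v) → ∃ λ p → p ∈ support (s ◅ w) × R p v
    last-step′ s ε = _ , here refl , s
    last-step′ s (s′ ◅ w) = let p , p∈ , r = last-step′ s′ w in p , there p∈ , r
  ... | p , p∈ , r′ = p , there p∈ , r′

module _ {A : Set} {R S : Rel A 0ℓ} (f : ∀ {x y} → R x y → S x y) where

  support-map : ∀ {u v} (w : Star R u v) → support (Star.map f w) ≡ support w
  support-map ε       = refl
  support-map (_ ◅ w) = cong (_ ∷_) (support-map w)

  arcs-map : ∀ {u v} (w : Star R u v) → arcs (Star.map f w) ≡ arcs w
  arcs-map ε       = refl
  arcs-map (_ ◅ w) = cong (_ ∷_) (arcs-map w)

module _ {A : Set} (_≟_ : DecidableEquality A) where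

  Arc : List (A × A) → Rel A 0ℓ
  Arc as x y = (x , y) ∈ as

  -- A walk either avoids the arc (a , b) or passes through it.
  walk? : ∀ as → Decidable (Star (Arc as))
  walk? [] u v = map′ (λ { refl → ε }) (λ { ε → refl }) (u ≟ v)
  walk? ((a , b) ∷ as) u v =
    map′ [ Star.map there , (λ (w , w′) → Star.map there w ◅◅ here refl ◅ Star.map there w′) ]′ split
         (walk? as u v ⊎-dec (walk? as u a ×-dec walk? as b v))
    where
    split : ∀ {u} → Star (Arc ((a , b) ∷ as)) u v →
            Star (Arc as) u v ⊎ (Star (Arc as) u a × Star (Arc as) b v)
    split ε = inj₁ ε
    split (here refl ◅ w) with split w
    ... | inj₁ w′        = inj₂ (ε , w′)
    ... | inj₂ (_ , w′)  = inj₂ (ε , w′)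
    split (there e ◅ w) with split w
    ... | inj₁ w′        = inj₁ (e ◅ w′)
    ... | inj₂ (w′ , w″) = inj₂ (e ◅ w′ , w″)

-- Menger's theorem

module Menger {A : Set} (_≟_ : DecidableEquality A) where
  open DecMembership _≟_ using (_∈?_)

  record Linkage (as : List (A × A)) (P Q : List A) (k : ℕ) : Set where
    field
      start end : Fin k → A
      start∈    : ∀ i → start i ∈ P
      end∈      : ∀ i → end i ∈ Q
      walk      : ∀ i → Star (Arc _≟_ as) (start i) (end i)
      simple    : ∀ i → Unique (support (walk i))
      disjoint  : ∀ {i j x} → x ∈ support (walk i) → x ∈ support (walk j) → i ≡ j

    start-injective : Injective _≡_ _≡_ start
    start-injective {i} {j} e =
      disjoint (start∈support (walk i)) (subst (_∈ support (walk j)) (sym e) (start∈support (walk j)))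

    end-injective : Injective _≡_ _≡_ end
    end-injective {i} {j} e =
      disjoint (end∈support (walk i)) (subst (_∈ support (walk j)) (sym e) (end∈support (walk j)))

  Separates : List (A × A) → List A → List A → List A → Set
  Separates as P Q X = ∀ {p q} → p ∈ P → q ∈ Q → (w : Star (Arc _≟_ as) p q) →
                       ∃ λ x → x ∈ X × x ∈ support w

  weaken : ∀ {a as P Q k} → Linkage as P Q k → Linkage (a ∷ as) P Q k
  weaken L = record
    { start = start ; end = end ; start∈ = start∈ ; end∈ = end∈
    ; walk     = Star.map there ∘ walk
    ; simple   = λ i → subst Unique (sym (support-map there (walk i))) (simple i)
    ; disjoint = λ {i} {j} x∈ x∈′ →
        disjoint (subst (_ ∈_) (support-map there (walk i)) x∈)
                 (subst (_ ∈_) (support-map there (walk j)) x∈′)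
    }
    where open Linkage L

  -- Without arcs every walk stays at its start, so the elements common to `P` and `Q` are both the
  -- possible walks and the smallest separator.
  trivial : ∀ P Q k → Linkage [] P Q k ⊎ ∃ λ X → length X ℕ.< k × Separates [] P Q X
  trivial P Q k with k ℕ.≤? length common
    where common = filter (_∈? Q) (deduplicate _≟_ P)
  ... | no k≰ = inj₂ (filter (_∈? Q) (deduplicate _≟_ P) , ℕ.≰⇒> k≰ ,
    λ { p∈ q∈ ε → _ , ∈-filter⁺ (_∈? Q) (∈-deduplicate⁺ _≟_ p∈) q∈ , here refl })
  ... | yes k≤ = inj₁ record
    { start = pick ; end = pick
    ; start∈ = λ i → ∈-deduplicate⁻ _≟_ P (proj₁ (pick∈ i))
    ; end∈ = λ i → proj₂ (pick∈ i)
    ; walk = λ _ → ε ; simple = λ _ → [] ∷ []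
    ; disjoint = λ { (here refl) (here e) → Fin.inject≤-injective k≤ k≤ _ _ (lookup-unique U e) }
    }
    where
    common = filter (_∈? Q) (deduplicate _≟_ P)
    U : Unique common
    U = Unique.filter⁺ (_∈? Q) (DecUnique.deduplicate-! _≟_ P)
    pick : Fin k → A
    pick i = lookup common (Fin.inject≤ i k≤)
    pick∈ : ∀ i → pick i ∈ deduplicate _≟_ P × pick i ∈ Q
    pick∈ i = ∈-filter⁻ (_∈? Q) (∈-lookup (Fin.inject≤ i k≤))

  module Step {a b : A} {as : List (A × A)} {P Q : List A} {k : ℕ} {S : List A}
              (S<k : length S ℕ.< k) (sep : Separates as P Q S) where

    W W⁺ : Rel A 0ℓ
    W  = Star (Arc _≟_ as)
    W⁺ = Star (Arc _≟_ ((a , b) ∷ as))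

    avoid-or-before : ∀ {u v} (w : W⁺ u v) →
      (∃ λ (w′ : W u v) → support w′ ≡ support w) ⊎ (∃ λ (w′ : W u a) → support w′ ⊆ support w)
    avoid-or-before ε = inj₁ (ε , refl)
    avoid-or-before (here refl ◅ w) = inj₂ (ε , λ { (here refl) → here refl })
    avoid-or-before (there e ◅ w) with avoid-or-before w
    ... | inj₁ (w′ , eq) = inj₁ (e ◅ w′ , cong (_ ∷_) eq)
    ... | inj₂ (w′ , ⊆w) =
      inj₂ (e ◅ w′ , λ { (here refl) → here refl ; (there x∈) → there (⊆w x∈) })

    avoid-or-after : ∀ {u v} (w : W⁺ u v) →
      (∃ λ (w′ : W u v) → support w′ ≡ support w) ⊎ (∃ λ (w′ : W b v) → support w′ ⊆ support w)
    avoid-or-after ε = inj₁ (ε , refl)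
    avoid-or-after (e ◅ w) with avoid-or-after w
    ... | inj₂ (w′ , ⊆w) = inj₂ (w′ , there ∘ ⊆w)
    avoid-or-after (here refl ◅ w) | inj₁ (w′ , eq) = inj₂ (w′ , λ x∈ → there (subst (_ ∈_) eq x∈))
    avoid-or-after (there e ◅ w) | inj₁ (w′ , eq) = inj₁ (e ◅ w′ , cong (_ ∷_) eq)

    -- A walk through the arc reaches `a` before its first use of it, and any other walk meets `S`.
    -- Either way an initial segment leads from `P` to `a ∷ S` without the arc.
    separates-before : ∀ {X} → Separates as P (a ∷ S) X → Separates ((a , b) ∷ as) P Q X
    separates-before sepX p∈ q∈ w with avoid-or-before w
    ... | inj₂ (w′ , ⊆w) =
      let x , x∈X , x∈w = sepX p∈ (here refl) w′ in x , x∈X , ⊆w x∈w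
    ... | inj₁ (w′ , eq) =
      let s , s∈S , s∈w  = sep p∈ q∈ w′
          w₁ , w₁⊆w′ , _ = prefix w′ s∈w
          x , x∈X , x∈w  = sepX p∈ (there s∈S) w₁
      in x , x∈X , subst (x ∈_) eq (w₁⊆w′ x∈w)

    separates-after : ∀ {X} → Separates as (b ∷ S) Q X → Separates ((a , b) ∷ as) P Q X
    separates-after sepX p∈ q∈ w with avoid-or-after w
    ... | inj₂ (w′ , ⊆w) =
      let x , x∈X , x∈w = sepX (here refl) q∈ w′ in x , x∈X , ⊆w x∈w
    ... | inj₁ (w′ , eq) =
      let s , s∈S , s∈w      = sep p∈ q∈ w′
          w₂ , w₂⊆w′ , _ , _ = suffix w′ s∈w
          x , x∈X , x∈w      = sepX (there s∈S) q∈ w₂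
      in x , x∈X , subst (x ∈_) eq (w₂⊆w′ x∈w)

    module Join (L : Linkage as P (a ∷ S) k) (M : Linkage as (b ∷ S) Q k) where
      private
        module L = Linkage L
        module M = Linkage M

      -- `S<k` says that `a ∷ S` has length at most k, so k distinct ends exhaust it.
      end-covers : ∀ {x} → x ∈ a ∷ S → ∃ λ i → L.end i ≡ x
      end-covers = injection-covers _≟_ L.end-injective L.end∈ S<k

      start-covers : ∀ {x} → x ∈ b ∷ S → ∃ λ i → M.start i ≡ x
      start-covers = injection-covers _≟_ M.start-injective M.start∈ S<k

      b∉S : b ∉ S
      b∉S b∈S = ℕ.<⇒≱ S<k (injection-length M.start-injective λ i → skip (M.start∈ i))
        where
        skip : ∀ {x} → x ∈ b ∷ S → x ∈ S
        skip (here refl) = b∈S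
        skip (there x∈)  = x∈

      -- Each element of `a ∷ S` is the end of some walk, so disjointness keeps it off the others.
      last-in : ∀ {i x} → x ∈ a ∷ S → x ∈ support (L.walk i) → x ≡ L.end i
      last-in x∈ x∈w with i′ , refl ← end-covers x∈ =
        cong L.end (L.disjoint (end∈support (L.walk i′)) x∈w)

      first-in : ∀ {j x} → x ∈ b ∷ S → x ∈ support (M.walk j) → x ≡ M.start j
      first-in x∈ x∈w with j′ , refl ← start-covers x∈ =
        cong M.start (M.disjoint (start∈support (M.walk j′)) x∈w)

      -- The part of `L.walk i` up to `x` and the part of `M.walk j` from `x` form a walk without
      -- the arc, which `S` must meet. An element of `S` on the first part is the end of `L.walk i`,
      -- so this part is the whole walk and `x` is that element; the second part is symmetric.
      crossing : ∀ {i j x} → x ∈ support (L.walk i) → x ∈ support (M.walk j) →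
                 x ∈ S × x ≡ L.end i × x ≡ M.start j
      crossing {i} {j} {x} x∈L x∈M =
        x∈S , last-in (there x∈S) x∈L , first-in (there x∈S) x∈M
        where
        w₁ = prefix (L.walk i) x∈L
        w₂ = suffix (M.walk j) x∈M
        x∈S : x ∈ S
        x∈S with s , s∈S , s∈w ← sep (L.start∈ i) (M.end∈ j) (proj₁ w₁ ◅◅ proj₁ w₂)
            with support-◅◅ (proj₁ w₁) (proj₁ w₂) s∈w
        ... | inj₁ s∈₁ = subst (_∈ S) (sym (trans x≡end (sym s≡end))) s∈S
          where
          s≡end = last-in (there s∈S) (proj₁ (proj₂ w₁) s∈₁)
          x≡end = proj₂ (proj₂ w₁) (L.simple i) (subst (_∈ support (proj₁ w₁)) s≡end s∈₁)
        ... | inj₂ s∈₂ = subst (_∈ S) (sym (trans x≡start (sym s≡start))) s∈S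
          where
          s≡start = first-in (there s∈S) (proj₁ (proj₂ w₂) s∈₂)
          x≡start = proj₂ (proj₂ (proj₂ w₂)) (M.simple j)
                      (subst (_∈ support (proj₁ w₂)) s≡start s∈₂)

      Meets : Fin k → Fin k → Set
      Meets i j = (L.end i ≡ a × M.start j ≡ b) ⊎ (L.end i ∈ S × L.end i ≡ M.start j)

      continue : ∀ i → ∃ (Meets i)
      continue i with L.end∈ i
      ... | here e = let j , e′ = start-covers (here refl) in j , inj₁ (e , e′)
      ... | there s∈ = let j , e = start-covers (there s∈) in j , inj₂ (s∈ , sym e)

      σ : Fin k → Fin k
      σ i = proj₁ (continue i)

      meets-injective : ∀ {i i′ j} → Meets i j → Meets i′ j → i ≡ i′
      meets-injective (inj₁ (e , _)) (inj₁ (e′ , _)) = L.end-injective (trans e (sym e′))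
      meets-injective (inj₂ (_ , e)) (inj₂ (_ , e′)) = L.end-injective (trans e (sym e′))
      meets-injective (inj₁ (_ , e)) (inj₂ (s∈ , e′)) =
        contradiction (subst (_∈ S) (trans e′ e) s∈) b∉S
      meets-injective (inj₂ (s∈ , e′)) (inj₁ (_ , e)) =
        contradiction (subst (_∈ S) (trans e′ e) s∈) b∉S

      crossing-meets : ∀ {i i′ j x} → Meets i′ j →
                       x ∈ support (L.walk i) → x ∈ support (M.walk j) → i ≡ i′
      crossing-meets m x∈L x∈M =
        let x∈S , e , e′ = crossing x∈L x∈M
        in meets-injective (inj₂ (subst (_∈ S) e x∈S , trans (sym e) e′)) m

      -- The continuation of `L.walk i`: either `M.walk j` itself, or the arc (a , b) followed by
      -- `M.walk j`. The field `only-end` keeps the joined walk simple.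
      record Tail (i j : Fin k) : Set where
        field
          tail     : W⁺ (L.end i) (M.end j)
          unique   : Unique (support tail)
          ⊆M       : ∀ {x} → x ∈ support tail → x ≡ L.end i ⊎ x ∈ support (M.walk j)
          only-end : ∀ {x} → x ∈ support (L.walk i) → x ∈ support tail → x ≡ L.end i

      tail-of : ∀ {i j} → Meets i j → Tail i j
      tail-of {i} {j} (inj₁ (ea , eb)) = record
        { tail     = here (cong₂ _,_ ea eb) ◅ w
        ; unique   = ∉⇒All≢ (λ a∈ → a∉ (subst (_ ∈_) (support-map there (M.walk j)) a∈)) ∷
                     subst Unique (sym (support-map there (M.walk j))) (M.simple j)
        ; ⊆M       = λ { (here e) → inj₁ e
                       ; (there x∈) → inj₂ (subst (_ ∈_) (support-map there (M.walk j)) x∈) }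
        ; only-end = λ { x∈ (here e) → e
                       ; x∈ (there x∈′) → proj₁ (proj₂ (crossing x∈
                           (subst (_ ∈_) (support-map there (M.walk j)) x∈′))) }
        }
        where
        w = Star.map there (M.walk j)
        a∉ : L.end i ∉ support (M.walk j)
        a∉ a∈ = let a∈S , _ , e = crossing (end∈support (L.walk i)) a∈
                in b∉S (subst (_∈ S) (trans e eb) a∈S)
      tail-of {i} {j} (inj₂ (s∈ , e)) = record
        { tail     = proj₁ tail
        ; unique   = subst Unique (sym (proj₂ tail)) (M.simple j)
        ; ⊆M       = λ x∈ → inj₂ (subst (_ ∈_) (proj₂ tail) x∈)
        ; only-end = λ x∈ x∈′ → proj₁ (proj₂ (crossing x∈ (subst (_ ∈_) (proj₂ tail) x∈′)))
        }
        where
        transport : ∀ {u v t} → u ≡ v → (w : W u t) →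
                    ∃ λ (w′ : W⁺ v t) → support w′ ≡ support w
        transport refl w = Star.map there w , support-map there w
        tail = transport (sym e) (M.walk j)

      join : Linkage ((a , b) ∷ as) P Q k
      join = record
        { start    = L.start
        ; end      = M.end ∘ σ
        ; start∈   = L.start∈
        ; end∈     = M.end∈ ∘ σ
        ; walk     = λ i → head i ◅◅ Tail.tail (tails i)
        ; simple   = λ i → unique-◅◅ (head i) (Tail.tail (tails i))
                       (subst Unique (sym (support-map there (L.walk i))) (L.simple i))
                       (Tail.unique (tails i))
                       (λ x∈ → Tail.only-end (tails i) (in-head i x∈))
        ; disjoint = λ {i} {i′} x∈ x∈′ → disjoint (parts i x∈) (parts i′ x∈′)
        }
        where
        head : ∀ i → W⁺ (L.start i) (L.end i)
        head i = Star.map there (L.walk i)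
        in-head : ∀ i {x} → x ∈ support (head i) → x ∈ support (L.walk i)
        in-head i = subst (_ ∈_) (support-map there (L.walk i))
        tails : ∀ i → Tail i (σ i)
        tails i = tail-of (proj₂ (continue i))
        parts : ∀ i {x} → x ∈ support (head i ◅◅ Tail.tail (tails i)) →
                x ∈ support (L.walk i) ⊎ x ∈ support (M.walk (σ i))
        parts i x∈ with support-◅◅ (head i) (Tail.tail (tails i)) x∈
        ... | inj₁ x∈h = inj₁ (in-head i x∈h)
        ... | inj₂ x∈t with Tail.⊆M (tails i) x∈t
        ... | inj₁ refl = inj₁ (end∈support (L.walk i))
        ... | inj₂ x∈M  = inj₂ x∈M
        disjoint : ∀ {i i′ x} → x ∈ support (L.walk i) ⊎ x ∈ support (M.walk (σ i)) →
                   x ∈ support (L.walk i′) ⊎ x ∈ support (M.walk (σ i′)) → i ≡ i′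
        disjoint (inj₁ x∈) (inj₁ x∈′) = L.disjoint x∈ x∈′
        disjoint {i} {i′} (inj₁ x∈) (inj₂ x∈′) = crossing-meets (proj₂ (continue i′)) x∈ x∈′
        disjoint {i} {i′} (inj₂ x∈) (inj₁ x∈′) =
          sym (crossing-meets (proj₂ (continue i)) x∈′ x∈)
        disjoint {i} {i′} (inj₂ x∈) (inj₂ x∈′) =
          meets-injective (subst (Meets i) (M.disjoint x∈ x∈′) (proj₂ (continue i)))
                          (proj₂ (continue i′))

  -- Göring's induction: if deleting the arc (a , b) leaves a small separator S, then
  -- P is linked to a ∷ S and b ∷ S to Q, and the two linkages only meet in S.
  menger : ∀ as P Q k → Linkage as P Q k ⊎ ∃ λ X → length X ℕ.< k × Separates as P Q X
  menger [] P Q k = trivial P Q k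
  menger ((a , b) ∷ as) P Q k with menger as P Q k
  ... | inj₁ L = inj₁ (weaken L)
  ... | inj₂ (S , S<k , sep) with menger as P (a ∷ S) k | menger as (b ∷ S) Q k
  ... | inj₂ (X , X<k , sepX) | _ = inj₂ (X , X<k , Step.separates-before S<k sep sepX)
  ... | inj₁ _ | inj₂ (X , X<k , sepX) = inj₂ (X , X<k , Step.separates-after S<k sep sepX)
  ... | inj₁ L | inj₁ M = inj₁ (Step.Join.join S<k sep L M)

-- Reachability, parity and colour switches

reachable? : ∀ {n} {R : Rel (Fin n) 0ℓ} → Decidable R → Decidable (Star R)
reachable? {n} {R} R? u v =
  map′ (Star.map λ xy∈ → proj₂ (∈-filter⁻ R×? {xs = pairs} xy∈))
       (Star.map λ r → ∈-filter⁺ R×? (∈-cartesianProduct⁺ (∈-allFin _) (∈-allFin _)) r)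
       (walk? Fin._≟_ (filter R×? pairs) u v)
  where
  pairs = cartesianProduct (allFin n) (allFin n)
  R×? : (xy : Fin n × Fin n) → Dec (R (proj₁ xy) (proj₂ xy))
  R×? (x , y) = R? x y

parity-suc : ∀ n → parity (suc n) ≡ parity n ⁻¹
parity-suc zero          = refl
parity-suc (suc zero)    = refl
parity-suc (suc (suc n)) = parity-suc n

module _ {d : ℕ} (α β : Fin d) where

  transpose-left : transpose α β α ≡ β
  transpose-left with α Fin.≟ α
  ... | yes _   = refl
  ... | no  α≢α = contradiction refl α≢α

  transpose-other : ∀ {γ} → γ ≢ α → γ ≢ β → transpose α β γ ≡ γ
  transpose-other {γ} γ≢α γ≢β with γ Fin.≟ α
  ... | yes γ≡α = contradiction γ≡α γ≢α
  ... | no  _ with γ Fin.≟ β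
  ... | yes γ≡β = contradiction γ≡β γ≢β
  ... | no  _   = refl

  transpose-injective : ∀ {γ δ} → transpose α β γ ≡ transpose α β δ → γ ≡ δ
  transpose-injective {γ} {δ} e =
    trans (sym (transpose-inverse β α)) (trans (cong (transpose β α) e) (transpose-inverse β α))

  transpose-right : transpose α β β ≡ α
  transpose-right with β Fin.≟ α
  ... | yes β≡α = β≡α
  ... | no  _ with β Fin.≟ β
  ... | yes _   = refl
  ... | no  β≢β = contradiction refl β≢β

  transpose-moves : ∀ {γ δ} → transpose α β γ ≡ δ → γ ≢ δ → (γ ≡ α × δ ≡ β) ⊎ (γ ≡ β × δ ≡ α)
  transpose-moves {γ} eq γ≢δ with γ Fin.≟ α
  ... | yes γ≡α = inj₁ (γ≡α , sym eq)
  ... | no  _ with γ Fin.≟ β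
  ... | yes γ≡β = inj₂ (γ≡β , sym eq)
  ... | no  _   = contradiction eq γ≢δ

  module _ {V : Set} (c : V → Fin d) {C : V → Set} (C? : ∀ x → Dec (C x)) where

    swapOn : V → Fin d
    swapOn x = if Dec.does (C? x) then transpose α β (c x) else c x

    swapOn-in : ∀ {x} → C x → swapOn x ≡ transpose α β (c x)
    swapOn-in {x} Cx with C? x
    ... | yes _   = refl
    ... | no  ¬Cx = contradiction Cx ¬Cx

    swapOn-out : ∀ {x} → ¬ C x → swapOn x ≡ c x
    swapOn-out {x} ¬Cx with C? x
    ... | yes Cx = contradiction Cx ¬Cx
    ... | no  _  = refl

    -- The transposition is injective, so only a pair with exactly one vertex in `C` can become
    -- monochromatic.
    swapOn-≢ : ∀ {x y} → c x ≢ c y →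
               (C x → ¬ C y → transpose α β (c x) ≢ c y) → (C y → ¬ C x → transpose α β (c y) ≢ c x) →
               swapOn x ≢ swapOn y
    swapOn-≢ {x} {y} x≢y xy yx with C? x | C? y
    ... | yes _  | yes _   = x≢y ∘ transpose-injective
    ... | yes Cx | no  ¬Cy = xy Cx ¬Cy
    ... | no ¬Cx | yes Cy  = yx Cy ¬Cx ∘ sym
    ... | no _   | no _    = x≢y

-- Immersions and Kempe chains

data Bichromatic {V : Set} {t : ℕ} (col : V → Fin t) (p q : Fin t) (x y : V) : Set where
  forth : col x ≡ p → col y ≡ q → Bichromatic col p q x y
  back  : col x ≡ q → col y ≡ p → Bichromatic col p q x y

module _ {V : Set} {t : ℕ} {col : V → Fin t} where

  bichromatic-sym : ∀ {p q x y} → Bichromatic col p q x y → Bichromatic col p q y x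
  bichromatic-sym (forth x y) = back y x
  bichromatic-sym (back x y)  = forth y x

  bichromatic? : ∀ p q x y → Dec (Bichromatic col p q x y)
  bichromatic? p q x y =
    map′ [ (λ (e , e′) → forth e e′) , (λ (e , e′) → back e e′) ]′
         (λ { (forth e e′) → inj₁ (e , e′) ; (back e e′) → inj₂ (e , e′) })
         ((col x Fin.≟ p ×-dec col y Fin.≟ q) ⊎-dec (col x Fin.≟ q ×-dec col y Fin.≟ p))

  -- A step determines the unordered pair of colours of its ends. Hence Kempe chains for different
  -- pairs of colours are edge-disjoint.
  bichromatic-unique : ∀ {p q p′ q′ x y} → p Fin.< q → p′ Fin.< q′ →
    Bichromatic col p q x y → Bichromatic col p′ q′ x y → p ≡ p′ × q ≡ q′
  bichromatic-unique _   _    (forth refl refl) (forth refl refl) = refl , refl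
  bichromatic-unique _   _    (back refl refl)  (back refl refl)  = refl , refl
  bichromatic-unique p<q p′<q′ (forth refl refl) (back refl refl) =
    contradiction p<q (ℕ.<-asym p′<q′)
  bichromatic-unique p<q p′<q′ (back refl refl) (forth refl refl) =
    contradiction p<q (ℕ.<-asym p′<q′)

data Pair {V : Set} {t : ℕ} (φ : Fin t → V) (p q : Fin t) : V → V → Set where
  straight : Pair φ p q (φ p) (φ q)
  reversed : Pair φ p q (φ q) (φ p)

module _ {V : Set} {t : ℕ} {φ : Fin t → V} where

  pair-sym : ∀ {p q x y} → Pair φ p q x y → Pair φ p q y x
  pair-sym straight = reversed
  pair-sym reversed = straight

  pair-unique : Injective _≡_ _≡_ φ → ∀ {p q p′ q′ x y x′ y′} → p Fin.< q → p′ Fin.< q′ →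
                Pair φ p q x y → Pair φ p′ q′ x′ y′ → x ≡ x′ → y ≡ y′ → p ≡ p′ × q ≡ q′
  pair-unique inj _ _ straight straight e e′ = inj e , inj e′
  pair-unique inj _ _ reversed reversed e e′ = inj e′ , inj e
  pair-unique inj p<q p′<q′ straight reversed e e′ with refl ← inj e | refl ← inj e′ =
    contradiction p<q (ℕ.<-asym p′<q′)
  pair-unique inj p<q p′<q′ reversed straight e e′ with refl ← inj e | refl ← inj e′ =
    contradiction p<q (ℕ.<-asym p′<q′)

module _ (G : Graph) where
  open Graph G

  vertices≡support : ∀ {u v} (w : Star Adj u v) → vertices {G} w ≡ support w
  vertices≡support ε       = refl
  vertices≡support (_ ◅ w) = cong (_ ∷_) (vertices≡support w)

  steps≡arcs : ∀ {u v} (w : Star Adj u v) → steps {G} w ≡ arcs w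
  steps≡arcs ε       = refl
  steps≡arcs (_ ◅ w) = cong (_ ∷_) (steps≡arcs w)

  -- `owned` is the local substitute for edge-disjointness, and `avoids` is the condition of a
  -- strong immersion.
  record Link {t} (φ : Fin t → Vertex) (Own : Rel Vertex 0ℓ) (u v : Vertex) : Set where
    field
      walk   : Star Adj u v
      simple : Unique (support walk)
      odd    : parity (length (arcs walk)) ≡ 1ℙ
      owned  : ∀ {x y} → (x , y) ∈ arcs walk → Own x y
      avoids : ∀ {r} → φ r ∈ support walk → φ r ≡ u ⊎ φ r ≡ v

  edgeLink : ∀ {t} {φ : Fin t → Vertex} {Own u v} → Adj u v → Own u v → Link φ Own u v
  edgeLink {u = u} {v} uv own = record
    { walk   = uv ◅ ε
    ; simple = ((λ u≡v → adj-irrefl u≡v uv) ∷ []) ∷ [] ∷ []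
    ; odd    = refl
    ; owned  = λ { (here refl) → own }
    ; avoids = λ { (here e) → inj₁ e ; (there (here e)) → inj₂ e }
    }

  -- Own p q is the set of steps reserved for the path between the terminals p and q.
  immersion : ∀ {t} (φ : Fin t → Vertex) → Injective _≡_ _≡_ φ →
              (Own : Fin t → Fin t → Rel Vertex 0ℓ) →
              (∀ {p q x y} → Own p q x y → Own p q y x) →
              (∀ {p q p′ q′ x y} → p Fin.< q → p′ Fin.< q′ →
                 Own p q x y → Own p′ q′ x y → p ≡ p′ × q ≡ q′) →
              (∀ {p q} → p Fin.< q → Link φ (Own p q) (φ p) (φ q)) →
              ContainsTotallyOddStrongImmersion G (complete t)
  immersion {t} φ φ-inj Own own-sym own-unique links =
    record { φ = φ ; φ-injective = φ-inj ; path = path ; edge-disjoint = disjoint } ,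
    (λ r e → λ (r∈ , r≢u , r≢v) →
      [ r≢u , r≢v ]′ (Link.avoids (link e)
        (subst (_ ∈_) (vertices≡support (Link.walk (link e))) r∈))) ,
    λ e → trans (cong (parity ∘ length) (steps≡arcs (Link.walk (link e)))) (Link.odd (link e))
    where
    open Graph.Edge
    ordered : (e : Graph.Edge (complete t)) → src e Fin.< tgt e
    ordered (edge p q p<q _) = recompute (p Fin.<? q) p<q
    link : (e : Graph.Edge (complete t)) → Link φ (Own (src e) (tgt e)) (φ (src e)) (φ (tgt e))
    link e = links (ordered e)
    path : (e : Graph.Edge (complete t)) → Path G (φ (src e)) (φ (tgt e))
    path e = record
      { walk     = Link.walk (link e)
      ; distinct = subst Unique (sym (vertices≡support (Link.walk (link e)))) (Link.simple (link e))
      }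
    owns : ∀ e {x y} → Path.Traverses (path e) (x , y) → Own (src e) (tgt e) x y
    owns e (inj₁ xy∈) = Link.owned (link e) (subst (_ ∈_) (steps≡arcs (Link.walk (link e))) xy∈)
    owns e (inj₂ yx∈) =
      own-sym (Link.owned (link e) (subst (_ ∈_) (steps≡arcs (Link.walk (link e))) yx∈))
    same-edge : ∀ (e f : Graph.Edge (complete t)) → src e ≡ src f × tgt e ≡ tgt f → e ≡ f
    same-edge _ _ (refl , refl) = refl
    disjoint : ∀ e f → e ≢ f → EdgeDisjoint (path e) (path f)
    disjoint e f e≢f (x , y) (xy∈e , xy∈f) =
      e≢f (same-edge e f (own-unique (ordered e) (ordered f) (owns e xy∈e) (owns f xy∈f)))

  -- A chain from colour p to colour q alternates and is therefore odd. It meets no third terminal,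
  -- since `φ r` has colour r.
  kempe-immersion : ∀ {t} (col : Vertex → Fin t) → (∀ {x y} → Adj x y → col x ≢ col y) →
    (φ : Fin t → Vertex) → (∀ p → col (φ p) ≡ p) →
    (∀ {p q} → p Fin.< q → Star (λ x y → Adj x y × Bichromatic col p q x y) (φ p) (φ q)) →
    ContainsTotallyOddStrongImmersion G (complete t)
  kempe-immersion {t} col proper φ col-φ linked =
    immersion φ (λ e → trans (sym (col-φ _)) (trans (cong col e) (col-φ _)))
      (Bichromatic col) bichromatic-sym bichromatic-unique link
    where
    Bi : Fin t → Fin t → Rel Vertex 0ℓ
    Bi p q x y = Adj x y × Bichromatic col p q x y

    alternates : ∀ {p q u v} → p ≢ q → (w : Star (Bi p q) u v) →
      (col u ≡ p → col v ≡ q → parity (length (arcs w)) ≡ 1ℙ) ×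
      (col u ≡ q → col v ≡ q → parity (length (arcs w)) ≡ 0ℙ)
    alternates p≢q ε = (λ e e′ → contradiction (trans (sym e) e′) p≢q) , λ _ _ → refl
    alternates p≢q ((_ , forth e e′) ◅ w) =
      (λ _ ev → trans (parity-suc (length (arcs w))) (cong _⁻¹ (proj₂ (alternates p≢q w) e′ ev))) ,
      (λ eu _ → contradiction (trans (sym e) eu) p≢q)
    alternates p≢q ((_ , back e e′) ◅ w) =
      (λ eu _ → contradiction (trans (sym eu) e) p≢q) ,
      (λ _ ev → trans (parity-suc (length (arcs w))) (cong _⁻¹ (proj₁ (alternates p≢q w) e′ ev)))

    colours : ∀ {p q u v x} (w : Star (Bi p q) u v) → col u ≡ p ⊎ col u ≡ q →
              x ∈ support w → col x ≡ p ⊎ col x ≡ q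
    colours ε cu (here refl) = cu
    colours (_ ◅ w) cu (here refl) = cu
    colours ((_ , forth _ e) ◅ w) _ (there x∈) = colours w (inj₂ e) x∈
    colours ((_ , back _ e) ◅ w) _ (there x∈) = colours w (inj₁ e) x∈

    link : ∀ {p q} → p Fin.< q → Link φ (Bichromatic col p q) (φ p) (φ q)
    link {p} {q} p<q = record
      { walk   = Star.map proj₁ w
      ; simple = subst Unique (sym (support-map proj₁ w)) (proj₂ simple-walk)
      ; odd    = trans (cong (parity ∘ length) (arcs-map proj₁ w))
                   (proj₁ (alternates (Fin.<⇒≢ p<q) w) (col-φ p) (col-φ q))
      ; owned  = λ xy∈ → proj₂ (arcs-related w (subst (_ ∈_) (arcs-map proj₁ w) xy∈))
      ; avoids = λ {r} r∈ →
          [ inj₁ ∘ cong φ ∘ trans (sym (col-φ r)) , inj₂ ∘ cong φ ∘ trans (sym (col-φ r)) ]′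
          (colours w (inj₁ (col-φ p)) (subst (_ ∈_) (support-map proj₁ w) r∈))
      }
      where
      simple-walk = simplify Fin._≟_ (linked p<q)
      w = proj₁ simple-walk

  -- When all d colours but no colour twice occur around e, the vertex e and its
  -- neighbours are the terminals: Kempe chains join any two of the neighbours.
  low-degree-immersion : ∀ {d} e (N : List Vertex) → (∀ {x} → Adj e x → x ∈ N) → length N ℕ.≤ d →
    (c : Vertex → Fin d) → (∀ {x y} → x ≢ e → y ≢ e → Adj x y → c x ≢ c y) →
    ¬ Colourable G d → ContainsTotallyOddStrongImmersion G (complete (suc d))
  low-degree-immersion {d} e N N-covers N≤d c c-proper ¬col =
    kempe-immersion col col-proper φ col-φ linked
    where
    -- A colour absent around `e` could be given to `e`, which would colour `G`. The colouring is a
    -- parameter because the argument is repeated after a Kempe switch.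
    sees : (c′ : Vertex → Fin d) → (∀ {x y} → x ≢ e → y ≢ e → Adj x y → c′ x ≢ c′ y) →
           ∀ γ → ∃ λ x → Adj e x × c′ x ≡ γ
    sees c′ proper′ γ with Fin.any? (λ x → adj? e x ×-dec c′ x Fin.≟ γ)
    ... | yes found = found
    ... | no ¬found = contradiction (c″ , proper″) ¬col
      where
      c″ : Vertex → Fin d
      c″ x with x Fin.≟ e
      ... | yes _ = γ
      ... | no  _ = c′ x
      proper″ : IsColouring G c″
      proper″ x y xy with x Fin.≟ e | y Fin.≟ e
      ... | yes refl | yes refl = λ _ → adj-irrefl refl xy
      ... | yes refl | no _     = λ γ≡ → ¬found (y , xy , sym γ≡)
      ... | no _     | yes refl = λ ≡γ → ¬found (x , adj-sym xy , ≡γ)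
      ... | no x≢e   | no y≢e   = proper′ x≢e y≢e xy

    nb : Fin d → Vertex
    nb γ = proj₁ (sees c c-proper γ)
    nb-adj : ∀ γ → Adj e (nb γ)
    nb-adj γ = proj₁ (proj₂ (sees c c-proper γ))
    c-nb : ∀ γ → c (nb γ) ≡ γ
    c-nb γ = proj₂ (proj₂ (sees c c-proper γ))

    only-nb : ∀ {x} → Adj e x → x ≡ nb (c x)
    only-nb ex with γ , refl ← injection-covers Fin._≟_
                    (λ eq → trans (sym (c-nb _)) (trans (cong c eq) (c-nb _)))
                    (N-covers ∘ nb-adj) N≤d (N-covers ex) = cong nb (sym (c-nb γ))

    nb≢e : ∀ γ → nb γ ≢ e
    nb≢e γ nb≡e = adj-irrefl (sym nb≡e) (nb-adj γ)

    -- A fresh colour makes the colouring proper at `e` and keeps `e` off the chains between its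
    -- neighbours.
    col : Vertex → Fin (suc d)
    col x with x Fin.≟ e
    ... | yes _ = zero
    ... | no  _ = suc (c x)

    col-off : ∀ {x} → x ≢ e → col x ≡ suc (c x)
    col-off {x} x≢e with x Fin.≟ e
    ... | yes x≡e = contradiction x≡e x≢e
    ... | no  _   = refl

    col-e : col e ≡ zero
    col-e with e Fin.≟ e
    ... | yes _   = refl
    ... | no  e≢e = contradiction refl e≢e

    col-proper : ∀ {x y} → Adj x y → col x ≢ col y
    col-proper {x} {y} xy with x Fin.≟ e | y Fin.≟ e
    ... | yes refl | yes refl = λ _ → adj-irrefl refl xy
    ... | yes _    | no _     = λ ()
    ... | no _     | yes _    = λ ()
    ... | no x≢e   | no y≢e   = c-proper x≢e y≢e xy ∘ Fin.suc-injective

    φ : Fin (suc d) → Vertex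
    φ zero    = e
    φ (suc γ) = nb γ

    col-φ : ∀ p → col (φ p) ≡ p
    col-φ zero    = col-e
    col-φ (suc γ) = trans (col-off (nb≢e γ)) (cong suc (c-nb γ))

    linked : ∀ {p q} → p Fin.< q → Star (λ x y → Adj x y × Bichromatic col p q x y) (φ p) (φ q)
    linked {zero}  {suc γ} _ = (nb-adj γ , forth col-e (col-φ (suc γ))) ◅ ε
    linked {suc γ} {suc δ} γ<δ with reachable? B? (nb γ) (nb δ)
      where
      B? : Decidable (λ x y → Adj x y × Bichromatic col (suc γ) (suc δ) x y)
      B? x y = adj? x y ×-dec bichromatic? (suc γ) (suc δ) x y
    ... | yes w = w
    ... | no ¬w = ⊥-elim absurd
      where
      B : Rel Vertex 0ℓ
      B x y = Adj x y × Bichromatic col (suc γ) (suc δ) x y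
      C : Vertex → Set
      C = Star B (nb γ)
      C? : ∀ x → Dec (C x)
      C? = reachable? (λ x y → adj? x y ×-dec bichromatic? (suc γ) (suc δ) x y) (nb γ)
      c′ = swapOn γ δ c C?
      mixed : ∀ {x y} → x ≢ e → y ≢ e → Adj x y → C x → ¬ C y → transpose γ δ (c x) ≢ c y
      mixed x≢e y≢e xy Cx ¬Cy eq with transpose-moves γ δ eq (c-proper x≢e y≢e xy)
      ... | inj₁ (cx , cy) = ¬Cy (Cx ◅◅ (xy , forth (trans (col-off x≢e) (cong suc cx))
                                                    (trans (col-off y≢e) (cong suc cy))) ◅ ε)
      ... | inj₂ (cx , cy) = ¬Cy (Cx ◅◅ (xy , back (trans (col-off x≢e) (cong suc cx))
                                                   (trans (col-off y≢e) (cong suc cy))) ◅ ε)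
      c′-proper : ∀ {x y} → x ≢ e → y ≢ e → Adj x y → c′ x ≢ c′ y
      c′-proper x≢e y≢e xy = swapOn-≢ γ δ c C? (c-proper x≢e y≢e xy)
        (mixed x≢e y≢e xy) (mixed y≢e x≢e (adj-sym xy))
      absurd : ⊥
      -- The switch would remove γ from around `e`: in `C` a new γ comes from δ, hence sits at
      -- `nb δ`, which is outside `C`; outside `C` an old γ sits at `nb γ`, which is in `C`.
      absurd with x , ex , c′x≡γ ← sees c′ c′-proper γ with C? x
      ... | yes Cx = ¬w (subst C (trans (only-nb ex) (cong nb cx≡δ)) Cx)
        where
        cx≡δ : c x ≡ δ
        cx≡δ = transpose-injective γ δ
          (trans (sym (swapOn-in γ δ c C? Cx)) (trans c′x≡γ (sym (transpose-right γ δ))))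
      ... | no ¬Cx = ¬Cx (subst C (sym (trans (only-nb ex) (cong nb cx≡γ))) ε)
        where
        cx≡γ : c x ≡ γ
        cx≡γ = trans (sym (swapOn-out γ δ c C? ¬Cx)) c′x≡γ

  clique-immersion : ∀ {t} (K : List Vertex) → Unique K → t ℕ.≤ length K →
    (∀ {x y} → x ∈ K → y ∈ K → x ≢ y → Adj x y) → ContainsTotallyOddStrongImmersion G (complete t)
  clique-immersion {t} K U t≤ clique = immersion φ φ-inj (Pair φ) pair-sym
    (λ p<q p′<q′ o o′ → pair-unique φ-inj p<q p′<q′ o o′ refl refl)
    λ p<q → edgeLink (clique (∈-lookup _) (∈-lookup _) (Fin.<⇒≢ p<q ∘ φ-inj)) straight
    where
    φ : Fin t → Vertex
    φ p = lookup K (Fin.inject≤ p t≤)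
    φ-inj : Injective _≡_ _≡_ φ
    φ-inj e = Fin.inject≤-injective t≤ t≤ _ _ (lookup-unique U e)

-- Free colours and recolouring

free-colour : ∀ {A : Set} {d} (c : A → Fin d) xs → length xs ℕ.< d → ∃ λ γ → ∀ {x} → x ∈ xs → c x ≢ γ
free-colour {A} {d} c xs xs<d with Fin.any? (λ γ → ¬? (Any.any? (λ x → c x Fin.≟ γ) xs))
... | yes (γ , ¬γ) = γ , λ x∈ cx≡γ → ¬γ (Any.map (λ { refl → cx≡γ }) x∈)
... | no ¬free = contradiction xs<d (ℕ.≤⇒≯ (injection-length f-inj f∈))
  where
  used : ∀ γ → Any (λ x → c x ≡ γ) xs
  used γ = decidable-stable (Any.any? (λ x → c x Fin.≟ γ) xs) λ ¬γ → ¬free (γ , ¬γ)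
  f : Fin d → A
  f γ = lookup xs (Any.index (used γ))
  f-inj : Injective _≡_ _≡_ f
  f-inj {γ} {δ} e =
    trans (sym (Any.lookup-index (used γ))) (trans (cong c e) (Any.lookup-index (used δ)))
  f∈ : ∀ γ → f γ ∈ xs
  f∈ γ = ∈-lookup (Any.index (used γ))

update : ∀ {n} {B : Set} → (Fin n → B) → Fin n → B → Fin n → B
update f x b y = if Dec.does (y Fin.≟ x) then b else f y

module _ {n : ℕ} {B : Set} (f : Fin n → B) (x : Fin n) (b : B) where

  update-other : ∀ {y} → y ≢ x → update f x b y ≡ f y
  update-other {y} y≢x with y Fin.≟ x
  ... | yes y≡x = contradiction y≡x y≢x
  ... | no  _   = refl

x∉p-x : ∀ {n} (p : Subset n) x → x ∉ˢ (p - x)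
x∉p-x p x x∈ = ℕ.<-irrefl (cong Subset.∣_∣ (Subset.p─q─q≡p─q p Subset.⁅ x ⁆)) (x∈p⇒∣p-x∣<∣p∣ x∈)

-- Vizing's theorem

module Line (H : Multigraph) where
  open Multigraph H

  V E : Set
  V = Fin order
  E = Fin size

  -- All edges of `H` remain vertices, those outside `D` being isolated, so that deleting edges does
  -- not change the vertex type.
  line : Subset size → Graph
  line D = record
    { order      = size
    ; Adj        = λ e f → e ∈ˢ D × f ∈ˢ D × G.Adj e f
    ; adj?       = λ e f → e ∈ˢ? D ×-dec f ∈ˢ? D ×-dec G.adj? e f
    ; adj-sym    = λ (e∈ , f∈ , ef) → f∈ , e∈ , G.adj-sym ef
    ; adj-irrefl = λ e≡f (_ , _ , ef) → G.adj-irrefl e≡f ef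
    }
    where module G = Graph (lineGraph H)

  -- If `t` is not an end of `e`, the value is the first end, and nothing is claimed about it.
  far : V → E → V
  far t e with t Fin.≟ proj₁ (ends e)
  ... | yes _ = proj₂ (ends e)
  ... | no  _ = proj₁ (ends e)

  incident⇒joins : ∀ {t e} → Incident t e → Joins t (far t e) e
  incident⇒joins {t} {e} t∈e with t Fin.≟ proj₁ (ends e) | t∈e
  ... | yes refl | _         = inj₁ refl
  ... | no  t≢   | inj₁ t≡   = contradiction t≡ t≢
  ... | no  _    | inj₂ refl = inj₂ refl

  joins-sym : ∀ {t s e} → Joins t s e → Joins s t e
  joins-sym (inj₁ eq) = inj₂ eq
  joins-sym (inj₂ eq) = inj₁ eq

  joins-incident : ∀ {t s e} → Joins t s e → Incident t e
  joins-incident (inj₁ eq) = inj₁ (sym (proj₁ (,-injective eq)))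
  joins-incident (inj₂ eq) = inj₂ (sym (proj₂ (,-injective eq)))

  joins-≢ : ∀ {t s e} → Joins t s e → t ≢ s
  joins-≢ {e = e} (inj₁ eq) refl = loopless e (trans (cong proj₁ eq) (sym (cong proj₂ eq)))
  joins-≢ {e = e} (inj₂ eq) refl = loopless e (trans (cong proj₁ eq) (sym (cong proj₂ eq)))

  joins-ends : ∀ {t s r e} → Joins t s e → Incident r e → r ≡ t ⊎ r ≡ s
  joins-ends (inj₁ eq) (inj₁ r≡) = inj₁ (trans r≡ (cong proj₁ eq))
  joins-ends (inj₁ eq) (inj₂ r≡) = inj₂ (trans r≡ (cong proj₂ eq))
  joins-ends (inj₂ eq) (inj₁ r≡) = inj₂ (trans r≡ (cong proj₁ eq))
  joins-ends (inj₂ eq) (inj₂ r≡) = inj₁ (trans r≡ (cong proj₂ eq))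

  joins-unique : ∀ {t s s′ e} → Joins t s e → Joins t s′ e → s ≡ s′
  joins-unique j j′ with joins-ends j (joins-incident (joins-sym j′))
  ... | inj₁ s′≡t = contradiction (sym s′≡t) (joins-≢ j′)
  ... | inj₂ s′≡s = sym s′≡s

  incident-two : ∀ {t s e} → Incident t e → Incident s e → t ≢ s → Joins t s e
  incident-two t∈ s∈ t≢s with joins-ends (incident⇒joins t∈) s∈
  ... | inj₁ s≡t  = contradiction (sym s≡t) t≢s
  ... | inj₂ refl = incident⇒joins t∈

  SimpleOn : Subset size → Set
  SimpleOn D = ∀ {e f t s} → e ∈ˢ D → f ∈ˢ D → Joins t s e → Joins t s f → e ≡ f

  star : Subset size → V → List E
  star D t = filter (λ e → e ∈ˢ? D ×-dec incident? t e) (allFin size)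

  star⁺ : ∀ {D t e} → e ∈ˢ D → Incident t e → e ∈ star D t
  star⁺ {D} {t} e∈ t∈ = ∈-filter⁺ (λ e → e ∈ˢ? D ×-dec incident? t e) (∈-allFin _) (e∈ , t∈)

  star⁻ : ∀ {D t e} → e ∈ star D t → e ∈ˢ D × Incident t e
  star⁻ {D} {t} e∈ = proj₂ (∈-filter⁻ (λ e → e ∈ˢ? D ×-dec incident? t e) {xs = allFin size} e∈)

  star-unique : ∀ D t → Unique (star D t)
  star-unique D t = Unique.filter⁺ (λ e → e ∈ˢ? D ×-dec incident? t e) (Unique.allFin⁺ size)

  degree : Subset size → V → ℕ
  degree D t = length (star D t)

  remove-⊆ : ∀ (D : Subset size) {e f} → f ∈ˢ (D - e) → f ∈ˢ D
  remove-⊆ D f∈ = p─q⊆p D _ f∈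

  -- Vizing's fan argument at u, with e₀ the only uncoloured edge of D.
  module Fan {d : ℕ} (D : Subset size) (simple : SimpleOn D)
             {e₀ : E} (e₀∈D : e₀ ∈ˢ D) {u : V} (u∈e₀ : Incident u e₀) where

    D′ : Subset size
    D′ = D - e₀

    ∈D : ∀ {f} → f ∈ˢ D′ → f ∈ˢ D
    ∈D f∈ = remove-⊆ D f∈

    ∈D′ : ∀ {f} → f ∈ˢ D → f ≢ e₀ → f ∈ˢ D′
    ∈D′ = x∈p∧x≢y⇒x∈p-y

    ∈D′⇒≢ : ∀ {f} → f ∈ˢ D′ → f ≢ e₀
    ∈D′⇒≢ f∈ refl = x∉p-x D e₀ f∈

    Colour : Set
    Colour = Fin d

    -- `c` is total, but only its values on `D′` are constrained; this is how `e₀` counts as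
    -- uncoloured.
    Proper : (E → Colour) → Set
    Proper c = ∀ {f g t} → f ∈ˢ D′ → g ∈ˢ D′ → f ≢ g → Incident t f → Incident t g → c f ≢ c g

    Misses : (E → Colour) → V → Colour → Set
    Misses c t γ = ∀ {f} → f ∈ˢ D′ → Incident t f → c f ≢ γ

    -- FanTo c f ps is a fan from e₀ to f; ps lists its edges before f, the latest first.
    data FanTo (c : E → Colour) : E → List E → Set where
      root : FanTo c e₀ []
      ext  : ∀ {f ps g} → FanTo c f ps → g ∈ˢ D′ → Incident u g → g ∉ f ∷ ps →
             Misses c (far u f) (c g) → FanTo c g (f ∷ ps)

    fan-edge : ∀ {c f ps} → FanTo c f ps → f ∈ˢ D × Incident u f
    fan-edge root                = e₀∈D , u∈e₀
    fan-edge (ext _ g∈ u∈g _ _) = ∈D g∈ , u∈g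

    fan-edges : ∀ {c f ps p} → FanTo c f ps → p ∈ f ∷ ps → p ∈ˢ D × Incident u p
    fan-edges F                (here refl) = fan-edge F
    fan-edges (ext F _ _ _ _) (there p∈)  = fan-edges F p∈

    fan-unique : ∀ {c f ps} → FanTo c f ps → Unique (f ∷ ps)
    fan-unique root                = [] ∷ []
    fan-unique (ext F _ _ g∉ _) = ∉⇒All≢ g∉ ∷ fan-unique F

    far-injective : ∀ {f g} → f ∈ˢ D → g ∈ˢ D → Incident u f → Incident u g →
                    far u f ≡ far u g → f ≡ g
    far-injective f∈ g∈ u∈f u∈g eq =
      simple f∈ g∈ (incident⇒joins u∈f) (subst (λ t → Joins u t _) (sym eq) (incident⇒joins u∈g))

    not-at-far : ∀ {f g} → f ∈ˢ D → g ∈ˢ D → Incident u f → Incident u g → f ≢ g →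
                 ∀ {h} → Incident (far u f) h → h ≢ g
    not-at-far f∈ g∈ u∈f u∈g f≢g t∈h refl =
      f≢g (simple f∈ g∈ (incident⇒joins u∈f)
        (incident-two u∈g t∈h (joins-≢ (incident⇒joins u∈f))))

    misses-both : ∀ {c g α t} → Incident u g → Misses c u α → Misses c (far u g) α →
                  Incident t g → Misses c t α
    misses-both u∈g mu mg t∈g with joins-ends (incident⇒joins u∈g) t∈g
    ... | inj₁ refl = mu
    ... | inj₂ refl = mg

    -- The fan conditions concern the far ends of edges other than `g`. By simplicity `g` is not
    -- incident with them, so its new colour cannot break the conditions.
    update-fan : ∀ {c f ps g α} → FanTo c f ps → g ∈ˢ D′ → Incident u g → g ∉ f ∷ ps →
                 FanTo (update c g α) f ps
    update-fan root g∈ u∈g g∉ = root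
    update-fan {c} {f} {p ∷ ps} {g} {α} (ext F f∈ u∈f f∉ mf) g∈ u∈g g∉ =
      ext (update-fan F g∈ u∈g (g∉ ∘ there)) f∈ u∈f f∉ λ {h} h∈ t∈h eq →
        mf h∈ t∈h (trans (sym (update-other c g α (not-at-far (proj₁ (fan-edge F)) (∈D g∈)
                           (proj₂ (fan-edge F)) u∈g (λ { refl → g∉ (there (here refl)) }) t∈h)))
                   (trans eq (update-other c g α λ { refl → g∉ (here refl) })))

    -- Giving α to the last edge frees its old colour at `u`, and by the fan condition this colour
    -- is also missing at the far end of the preceding edge. The recolouring thus moves down the fan
    -- until `e₀` receives a colour.
    rotate : ∀ ps {c f α} → Proper c → FanTo c f ps → Misses c u α → Misses c (far u f) α →
             Colourable (line D) d
    rotate [] {c} {_} {α} proper root mu mf = update c e₀ α , colouring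
      where
      colouring : IsColouring (line D) (update c e₀ α)
      colouring f g (f∈ , g∈ , f≢g , t , t∈f , t∈g) with f Fin.≟ e₀ | g Fin.≟ e₀
      ... | yes refl | yes refl = contradiction refl f≢g
      ... | yes refl | no  g≢   = misses-both u∈e₀ mu mf t∈f (∈D′ g∈ g≢) t∈g ∘ sym
      ... | no  f≢   | yes refl = misses-both u∈e₀ mu mf t∈g (∈D′ f∈ f≢) t∈f
      ... | no  f≢   | no  g≢   = proper (∈D′ f∈ f≢) (∈D′ g∈ g≢) f≢g t∈f t∈g
    rotate (f ∷ ps) {c} {g} {α} proper (ext F g∈ u∈g g∉ mg) mu mα =
      rotate ps proper′ (update-fan F g∈ u∈g g∉) mu′ mf′
      where
      c′ = update c g α
      proper′ : Proper c′
      proper′ {h} {k} h∈ k∈ h≢k t∈h t∈k with h Fin.≟ g | k Fin.≟ g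
      ... | yes refl | yes refl = contradiction refl h≢k
      ... | yes refl | no  _    = misses-both u∈g mu mα t∈h k∈ t∈k ∘ sym
      ... | no  _    | yes refl = misses-both u∈g mu mα t∈k h∈ t∈h
      ... | no  _    | no  _    = proper h∈ k∈ h≢k t∈h t∈k
      mu′ : Misses c′ u (c g)
      mu′ {h} h∈ u∈h with h Fin.≟ g
      ... | yes refl = mu h∈ u∈h ∘ sym
      ... | no  h≢g  = proper h∈ g∈ h≢g u∈h u∈g
      mf′ : Misses c′ (far u f) (c g)
      mf′ {h} h∈ t∈h eq = mg h∈ t∈h (trans (sym (update-other c g α
        (not-at-far (proj₁ (fan-edge F)) (∈D g∈) (proj₂ (fan-edge F)) u∈g
          (λ { refl → g∉ (here refl) }) t∈h))) eq)

    predecessor : ∀ {c f ps g} → FanTo c f ps → g ∈ f ∷ ps → g ≢ e₀ →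
                  ∃ λ h → h ∈ ps × Misses c (far u h) (c g)
    predecessor root (here refl) g≢ = contradiction refl g≢
    predecessor (ext F _ _ _ m) (here refl) _ = _ , here refl , m
    predecessor (ext F _ _ _ _) (there g∈) g≢ =
      let h , h∈ , m = predecessor F g∈ g≢ in h , there h∈ , m

    module Kempe {c : E → Colour} (proper : Proper c) (α β : Colour) (uα : Misses c u α) where

      αβ : Colour → Set
      αβ γ = γ ≡ α ⊎ γ ≡ β

      R : Rel V 0ℓ
      R t s = ∃ λ e → e ∈ˢ D′ × αβ (c e) × Joins t s e

      R? : Decidable R
      R? t s = Fin.any? λ e → e ∈ˢ? D′ ×-dec (c e Fin.≟ α ⊎-dec c e Fin.≟ β) ×-dec joins? t s e

      C : V → Set
      C = Star R u

      C? : ∀ t → Dec (C t)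
      C? = reachable? R? u

      spread : ∀ {e t s} → e ∈ˢ D′ → αβ (c e) → Incident t e → Incident s e → C t → C s
      spread {e} {t} {s} e∈ γ t∈ s∈ Ct with s Fin.≟ t
      ... | yes refl = Ct
      ... | no  s≢t  = Ct ◅◅ (e , e∈ , γ , incident-two t∈ s∈ (s≢t ∘ sym)) ◅ ε

      -- An edge coloured α or β has both ends in `C` or neither, and the other colours are fixed by
      -- the switch, so testing one end is enough.
      src? : ∀ e → Dec (C (proj₁ (ends e)))
      src? e = C? (proj₁ (ends e))

      c′ : E → Colour
      c′ = swapOn α β c src?

      τ : Colour → Colour
      τ = transpose α β

      fixed : ∀ {γ} → ¬ αβ γ → τ γ ≡ γ
      fixed ¬αβ = transpose-other α β (¬αβ ∘ inj₁) (¬αβ ∘ inj₂)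

      αβ? : ∀ γ → Dec (αβ γ)
      αβ? γ = γ Fin.≟ α ⊎-dec γ Fin.≟ β

      c′-in : ∀ {e t} → e ∈ˢ D′ → Incident t e → C t → c′ e ≡ τ (c e)
      c′-in {e} e∈ t∈ Ct = by (src? e) (αβ? (c e))
        where
        by : Dec (C (proj₁ (ends e))) → Dec (αβ (c e)) → c′ e ≡ τ (c e)
        by (yes Cs) _       = swapOn-in α β c src? Cs
        by (no ¬Cs) (yes γ) = contradiction (spread e∈ γ t∈ (inj₁ refl) Ct) ¬Cs
        by (no ¬Cs) (no ¬γ) = trans (swapOn-out α β c src? ¬Cs) (sym (fixed ¬γ))

      c′-out : ∀ {e t} → e ∈ˢ D′ → Incident t e → ¬ C t → c′ e ≡ c e
      c′-out {e} e∈ t∈ ¬Ct = by (src? e) (αβ? (c e))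
        where
        by : Dec (C (proj₁ (ends e))) → Dec (αβ (c e)) → c′ e ≡ c e
        by (no ¬Cs) _       = swapOn-out α β c src? ¬Cs
        by (yes Cs) (yes γ) = contradiction (spread e∈ γ (inj₁ refl) t∈ Cs) ¬Ct
        by (yes Cs) (no ¬γ) = trans (swapOn-in α β c src? Cs) (fixed ¬γ)

      proper′ : Proper c′
      proper′ {f} {g} {t} f∈ g∈ f≢g t∈f t∈g eq = by (C? t)
        where
        by : Dec (C t) → ⊥
        by (yes Ct) = proper f∈ g∈ f≢g t∈f t∈g (transpose-injective α β
          (trans (sym (c′-in f∈ t∈f Ct)) (trans eq (c′-in g∈ t∈g Ct))))
        by (no ¬Ct) = proper f∈ g∈ f≢g t∈f t∈g
          (trans (sym (c′-out f∈ t∈f ¬Ct)) (trans eq (c′-out g∈ t∈g ¬Ct)))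

      misses-in : ∀ {t γ} → C t → Misses c t γ → Misses c′ t (τ γ)
      misses-in Ct m f∈ t∈f eq =
        m f∈ t∈f (transpose-injective α β (trans (sym (c′-in f∈ t∈f Ct)) eq))

      misses-out : ∀ {t γ} → ¬ C t → Misses c t γ → Misses c′ t γ
      misses-out ¬Ct m f∈ t∈f eq = m f∈ t∈f (trans (sym (c′-out f∈ t∈f ¬Ct)) eq)

      -- At a far end in `C` both sides of the fan condition are transposed. At one outside `C` the
      -- required colour is not α, which is missing at `u`, and not β by hypothesis, so nothing
      -- changes.
      swap-fan : ∀ {f ps} → FanTo c f ps → (∀ {p} → p ∈ ps → Misses c (far u p) β → C (far u p)) →
                 FanTo c′ f ps
      swap-fan root _ = root
      swap-fan (ext {f} {ps} {g} F g∈ u∈g g∉ m) inC =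
        ext (swap-fan F (inC ∘ there)) g∈ u∈g g∉ (by (C? (far u f)))
        where
        c′g≡τ : c′ g ≡ τ (c g)
        c′g≡τ = c′-in g∈ u∈g ε
        by : Dec (C (far u f)) → Misses c′ (far u f) (c′ g)
        by (yes Cf) = subst (Misses c′ (far u f)) (sym c′g≡τ) (misses-in Cf m)
        by (no ¬Cf) = subst (Misses c′ (far u f)) (sym (trans c′g≡τ (fixed
          λ { (inj₁ cg≡α) → uα g∈ u∈g cg≡α
            ; (inj₂ cg≡β) → ¬Cf (inC (here refl) (subst (Misses c (far u f)) cg≡β m)) })))
          (misses-out ¬Cf m)

      -- At the first fan edge whose far end lies outside `C` and misses β, the switch makes β
      -- missing at `u` too and preserves the fan up to this edge, which can then be rotated.
      colour-or-reach : ∀ {f ps} → FanTo c f ps → Colourable (line D) d ⊎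
                        (∀ {p} → p ∈ f ∷ ps → Misses c (far u p) β → C (far u p))
      colour-or-reach {f} {ps} F = before F (C? (far u f)) (Fin.all? misses?)
        where
        misses? : ∀ e → Dec (e ∈ˢ D′ → Incident (far u f) e → c e ≢ β)
        misses? e = e ∈ˢ? D′ →-dec incident? (far u f) e →-dec ¬? (c e Fin.≟ β)
        InC : List E → Set
        InC es = ∀ {p} → p ∈ es → Misses c (far u p) β → C (far u p)
        cons : InC ps → (Misses c (far u f) β → C (far u f)) → InC (f ∷ ps)
        cons inC inCf (here refl) = inCf
        cons inC inCf (there p∈)  = inC p∈
        last : InC ps → Dec (C (far u f)) → Dec (∀ e → e ∈ˢ D′ → Incident (far u f) e → c e ≢ β) →
               Colourable (line D) d ⊎ InC (f ∷ ps)
        last inC (yes Cf) _       = inj₂ (cons inC λ _ → Cf)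
        last inC (no ¬Cf) (no ¬m) = inj₂ (cons inC λ m → contradiction (λ e → m {e}) ¬m)
        last inC (no ¬Cf) (yes m) = inj₁ (rotate ps proper′ (swap-fan F inC)
          (subst (Misses c′ u) (transpose-left α β) (misses-in ε uα)) (misses-out ¬Cf (m _)))
        before : FanTo c f ps → Dec (C (far u f)) →
                 Dec (∀ e → e ∈ˢ D′ → Incident (far u f) e → c e ≢ β) →
                 Colourable (line D) d ⊎ InC (f ∷ ps)
        before root Cf? m? = last (λ ()) Cf? m?
        before (ext F′ _ _ _ _) Cf? m? with colour-or-reach F′
        ... | inj₁ col = inj₁ col
        ... | inj₂ inC = last inC Cf? m?

      -- The chain through u starts with colour β, as α is missing at u.
      next : ℕ → Colour
      next zero    = β
      next (suc n) = τ (next n)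

      next-β : ∀ n → (next n ≡ β × next (suc n) ≡ α) ⊎ (next n ≡ α × next (suc n) ≡ β)
      next-β zero = inj₁ (refl , transpose-right α β)
      next-β (suc n) with next-β n
      ... | inj₁ (_ , ≡α) = inj₂ (≡α , trans (cong τ ≡α) (transpose-left α β))
      ... | inj₂ (_ , ≡β) = inj₁ (≡β , trans (cong τ ≡β) (transpose-right α β))

      next-αβ : ∀ n {γ} → αβ γ → γ ≡ next n ⊎ γ ≡ next (suc n)
      next-αβ n γ with next-β n | γ
      ... | inj₁ (n≡ , s≡) | inj₁ refl = inj₂ (sym s≡)
      ... | inj₁ (n≡ , s≡) | inj₂ refl = inj₁ (sym n≡)
      ... | inj₂ (n≡ , s≡) | inj₁ refl = inj₁ (sym n≡)
      ... | inj₂ (n≡ , s≡) | inj₂ refl = inj₂ (sym s≡)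

      data Reach : ℕ → V → Set where
        start : Reach zero u
        go    : ∀ {n t s e} → Reach n t → e ∈ˢ D′ → c e ≡ next n → Joins t s e → Reach (suc n) s

      same-edge : ∀ {f g t} → f ∈ˢ D′ → g ∈ˢ D′ → Incident t f → Incident t g → c f ≡ c g → f ≡ g
      same-edge {f} {g} f∈ g∈ t∈f t∈g eq with f Fin.≟ g
      ... | yes f≡g = f≡g
      ... | no  f≢g = contradiction eq (proper f∈ g∈ f≢g t∈f t∈g)

      reach-closed : ∀ {n t s} → Reach n t → R t s → ∃ λ m → Reach m s
      reach-closed start (e , e∈ , inj₁ ≡α , j) = contradiction ≡α (uα e∈ (joins-incident j))
      reach-closed start (e , e∈ , inj₂ ≡β , j) = _ , go start e∈ ≡β j
      reach-closed (go {n} r f∈ cf jf) (e , e∈ , γ , j) with next-αβ n γ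
      ... | inj₂ ce = _ , go (go r f∈ cf jf) e∈ ce j
      -- An edge of the colour by which the chain arrived is the arriving edge itself, so the step
      -- leads back.
      ... | inj₁ ce with refl ← same-edge e∈ f∈ (joins-incident j) (joins-incident (joins-sym jf))
                               (trans ce (sym cf))
                    with refl ← joins-unique j (joins-sym jf) = n , r

      reach : ∀ {t} → C t → ∃ λ n → Reach n t
      reach = from start
        where
        from : ∀ {n t s} → Reach n t → Star R t s → ∃ λ m → Reach m s
        from r ε       = _ , r
        from r (e ◅ w) = from (proj₂ (reach-closed r e)) w

      reach-unique : ∀ {n t s} → Reach n t → Reach n s → t ≡ s
      reach-unique start start = refl
      reach-unique (go r e∈ ce j) (go r′ f∈ cf j′) with refl ← reach-unique r r′
        with refl ← same-edge e∈ f∈ (joins-incident j) (joins-incident j′) (trans ce (sym cf)) =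
        joins-unique j j′

      Has : V → Colour → Set
      Has t γ = ∃ λ e → e ∈ˢ D′ × Incident t e × c e ≡ γ

      departs : ∀ {n m t s} → n ℕ.< m → Reach n t → Reach m s → Has t (next n)
      departs {n} {suc m} (s≤s n≤m) r (go r′ e∈ ce j) with ℕ.m≤n⇒m<n∨m≡n n≤m
      ... | inj₁ n<m  = departs n<m r r′
      ... | inj₂ refl with refl ← reach-unique r r′ = _ , e∈ , joins-incident j , ce

      no-longer : ∀ {n m t s} → n ℕ.< m → Reach n t → Reach m s → t ≢ u → ¬ Misses c t β
      no-longer _ start _ t≢u _ = t≢u refl
      no-longer n<m r@(go {n} _ e∈ ce j) r′ _ mβ with next-β n | departs n<m r r′
      ... | inj₁ (≡β , _) | _ = mβ e∈ (joins-incident (joins-sym j)) (trans ce ≡β)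
      ... | inj₂ (_ , ≡β) | f , f∈ , t∈f , cf = mβ f∈ t∈f (trans cf ≡β)

      -- If the two vertices were reached after different numbers of steps, the chain would both
      -- enter and leave the earlier one, which would then see α and β.
      one-end : ∀ {t s} → C t → C s → t ≢ u → s ≢ u → Misses c t β → Misses c s β → t ≡ s
      one-end Ct Cs t≢u s≢u mt ms with reach Ct | reach Cs
      ... | n , r | m , r′ with ℕ.<-cmp n m
      ... | tri< n<m _ _    = ⊥-elim (no-longer n<m r r′ t≢u mt)
      ... | tri≈ _ refl _   = reach-unique r r′
      ... | tri> _ _ m<n    = ⊥-elim (no-longer m<n r′ r s≢u ms)

    -- The fan grows by the edge at `u` whose colour is missing at the last far end. If there is no
    -- such edge, the fan is rotated; if the edge is already on the fan, two far ends miss its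
    -- colour and a Kempe switch helps.
    vizing : ∀ {c} → Proper c → (∃ λ α → Misses c u α) →
             (∀ {f} → f ∈ˢ D → Incident u f → ∃ λ γ → Misses c (far u f) γ) →
             Colourable (line D) d
    vizing {c} proper (α , uα) free = grow size root (ℕ.m≤n+m size 0)
      where
      grow : ∀ n {f ps} → FanTo c f ps → size ℕ.≤ length ps ℕ.+ n → Colourable (line D) d
      grow n {f} {ps} F bound with free (proj₁ (fan-edge F)) (proj₂ (fan-edge F))
      ... | β , mβ with Fin.any? (λ g → g ∈ˢ? D′ ×-dec incident? u g ×-dec c g Fin.≟ β)
      ... | no ¬g = rotate ps proper F (λ g∈ u∈g cg → ¬g (_ , g∈ , u∈g , cg)) mβ
      ... | yes (g , g∈ , u∈g , refl) with Any.any? (g Fin.≟_) (f ∷ ps)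
      -- Without fuel, `f ∷ ps` would be a list of more than `size` distinct edges.
      grow zero {f} {ps} F bound | _ | _ | no _ =
        contradiction (ℕ.≤-trans bound (ℕ.≤-reflexive (ℕ.+-identityʳ _))) (ℕ.<⇒≱ (ℕ.≤-trans
          (unique-⊆-length (fan-unique F) λ {x} _ → ∈-allFin x)
          (ℕ.≤-reflexive (List.length-tabulate id))))
      grow (suc n) {f} {ps} F bound | _ , mβ | yes (_ , g∈ , u∈g , refl) | no g∉ =
        grow n (ext F g∈ u∈g g∉ mβ) (ℕ.≤-trans bound (ℕ.≤-reflexive (ℕ.+-suc (length ps) n)))
      ... | yes g∈f∷ps with predecessor F g∈f∷ps (∈D′⇒≢ g∈)
      -- The far ends of `h` and `f` both miss `c g`. They are distinct and differ from `u`, so they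
      -- cannot both lie on the chain from `u`.
      ... | h , h∈ , mh with Kempe.colour-or-reach proper α (c g) uα F
      ... | inj₁ col = col
      ... | inj₂ inC = contradiction
        (far-injective (proj₁ h-edge) (proj₁ f-edge) (proj₂ h-edge) (proj₂ f-edge)
          (Kempe.one-end proper α (c g) uα (inC (there h∈) mh) (inC (here refl) mβ)
            (joins-≢ (incident⇒joins (proj₂ h-edge)) ∘ sym)
            (joins-≢ (incident⇒joins (proj₂ f-edge)) ∘ sym) mh mβ))
        λ { refl → unique-head (fan-unique F) h∈ }
        where
        h-edge = fan-edges F (there h∈)
        f-edge = fan-edge F

colourable-mono : ∀ {G j k} → j ℕ.≤ k → Colourable G j → Colourable G k
colourable-mono j≤k (c , proper) =
  (λ x → Fin.inject≤ (c x) j≤k) , λ x y xy e → proper x y xy (Fin.inject≤-injective j≤k j≤k _ _ e)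

colourable? : ∀ G k → Dec (Colourable G k)
colourable? G k with χ G ℕ.≤? k
... | yes χ≤k = yes (colourable-mono {G} χ≤k (proj₁ (proj₂ (chromaticNumber G))))
... | no  χ≰k = no λ col → χ≰k (proj₂ (proj₂ (chromaticNumber G)) k col)

-- Edge cuts

indicator : Bool → ℕ
indicator b = if b then 1 else 0

length-filter-∷ : ∀ {A : Set} {P : A → Set} (P? : ∀ x → Dec (P x)) x xs →
                  length (filter P? (x ∷ xs)) ≡ indicator (Dec.does (P? x)) ℕ.+ length (filter P? xs)
length-filter-∷ P? x xs with P? x
... | yes _ = refl
... | no  _ = refl

module _ {A : Set} {P Q P′ Q′ : A → Set} (P? : ∀ x → Dec (P x)) (Q? : ∀ x → Dec (Q x))
         (P′? : ∀ x → Dec (P′ x)) (Q′? : ∀ x → Dec (Q′ x)) where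

  length-filter-+-mono :
    (∀ x → indicator (Dec.does (P? x)) ℕ.+ indicator (Dec.does (Q? x)) ℕ.≤
           indicator (Dec.does (P′? x)) ℕ.+ indicator (Dec.does (Q′? x))) →
    ∀ xs → length (filter P? xs) ℕ.+ length (filter Q? xs) ℕ.≤
           length (filter P′? xs) ℕ.+ length (filter Q′? xs)
  length-filter-+-mono le [] = z≤n
  length-filter-+-mono le (x ∷ xs)
    rewrite length-filter-∷ P? x xs | length-filter-∷ Q? x xs
          | length-filter-∷ P′? x xs | length-filter-∷ Q′? x xs
          | interchange ℕ.+-commutativeSemigroup (indicator (Dec.does (P? x))) (length (filter P? xs))
                        (indicator (Dec.does (Q? x))) (length (filter Q? xs))
          | interchange ℕ.+-commutativeSemigroup (indicator (Dec.does (P′? x))) (length (filter P′? xs))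
                        (indicator (Dec.does (Q′? x))) (length (filter Q′? xs))
    = ℕ.+-mono-≤ (le x) (length-filter-+-mono le xs)

-- Submodularity of the cut function for a single edge: p and q tell whether its ends lie in the
-- first set, p′ and q′ in the second. It is strict only for an edge between the two set
-- differences.
xor-submodular : ∀ p q p′ q′ →
  indicator ((p ∧ p′) xor (q ∧ q′)) ℕ.+ indicator ((p ∨ p′) xor (q ∨ q′)) ℕ.≤
  indicator (p xor q) ℕ.+ indicator (p′ xor q′)
xor-submodular false false p′    q′    = ℕ.≤-refl
xor-submodular true  true  p′    q′    = ℕ.≤-reflexive (ℕ.+-identityʳ _)
xor-submodular true  false true  true  = ℕ.≤-refl
xor-submodular true  false true  false = ℕ.≤-refl
xor-submodular true  false false true  = z≤n
xor-submodular true  false false false = ℕ.≤-refl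
xor-submodular false true  true  true  = ℕ.≤-refl
xor-submodular false true  true  false = z≤n
xor-submodular false true  false true  = ℕ.≤-refl
xor-submodular false true  false false = ℕ.≤-refl

module Cuts (H : Multigraph) where
  open Multigraph H
  open Line H

  module Cut (D : Subset size) where

    crosses : Subset order → E → Bool
    crosses S e = Vec.lookup S (proj₁ (ends e)) xor Vec.lookup S (proj₂ (ends e))

    crossing? : ∀ S e → Dec (e ∈ˢ D × T (crosses S e))
    crossing? S e = e ∈ˢ? D ×-dec T? (crosses S e)


    boundary : Subset order → List E
    boundary S = filter (crossing? S) (allFin size)

    cut : Subset order → ℕ
    cut S = length (boundary S)

    boundary-unique : ∀ S → Unique (boundary S)
    boundary-unique S = Unique.filter⁺ (crossing? S) (Unique.allFin⁺ size)

    ∈⇒true : ∀ {S : Subset order} {t} → t ∈ˢ S → Vec.lookup S t ≡ true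
    ∈⇒true = Vec.[]=⇒lookup

    ∉⇒false : ∀ {S : Subset order} {t} → t ∉ˢ S → Vec.lookup S t ≡ false
    ∉⇒false {S} {t} t∉ with Vec.lookup S t in eq
    ... | true  = contradiction (Vec.lookup⇒[]= t S eq) t∉
    ... | false = refl

    boundary⁺ : ∀ S {s t e} → e ∈ˢ D → Joins s t e → s ∈ˢ S → t ∉ˢ S → e ∈ boundary S
    boundary⁺ S {s} {t} {e} e∈ j s∈ t∉ = ∈-filter⁺ (crossing? S) (∈-allFin e) (e∈ , cross j)
      where
      cross : Joins s t e → T (crosses S e)
      cross (inj₁ eq) rewrite eq | ∈⇒true {S} s∈ | ∉⇒false {S} t∉ = _
      cross (inj₂ eq) rewrite eq | ∈⇒true {S} s∈ | ∉⇒false {S} t∉ = _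

    boundary⁻ : ∀ S {e} → e ∈ boundary S → e ∈ˢ D × ∃₂ λ s t → Joins s t e × s ∈ˢ S × t ∉ˢ S
    boundary⁻ S {e} e∈ with ∈-filter⁻ (crossing? S) {xs = allFin size} e∈
    ... | _ , e∈D , cross
        with Vec.lookup S (proj₁ (ends e)) in eq | Vec.lookup S (proj₂ (ends e)) in eq′
    ... | true | false = e∈D , _ , _ , inj₁ refl , Vec.lookup⇒[]= _ S eq ,
                         λ t∈ → contradiction (trans (sym (∈⇒true {S} t∈)) eq′) λ ()
    ... | false | true = e∈D , _ , _ , inj₂ refl , Vec.lookup⇒[]= _ S eq′ ,
                         λ t∈ → contradiction (trans (sym (∈⇒true {S} t∈)) eq) λ ()

    inner-end-unique : ∀ {S e s t} → e ∈ boundary S → Incident s e → Incident t e →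
                       s ∈ˢ S → t ∈ˢ S → s ≡ t
    inner-end-unique {S} e∈ s∈e t∈e s∈ t∈ with _ , p , q , j , p∈ , q∉ ← boundary⁻ S e∈
      with joins-ends j s∈e | joins-ends j t∈e
    ... | inj₁ refl | inj₁ refl = refl
    ... | inj₂ refl | _         = contradiction s∈ q∉
    ... | _         | inj₂ refl = contradiction t∈ q∉

    submodular : ∀ S S′ → cut (S ∩ S′) ℕ.+ cut (S ∪ S′) ℕ.≤ cut S ℕ.+ cut S′
    submodular S S′ = length-filter-+-mono (crossing? (S ∩ S′)) (crossing? (S ∪ S′)) (crossing? S)
      (crossing? S′) pointwise (allFin size)
      where
      pointwise : ∀ e → indicator (Dec.does (crossing? (S ∩ S′) e)) ℕ.+
                        indicator (Dec.does (crossing? (S ∪ S′) e)) ℕ.≤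
                        indicator (Dec.does (crossing? S e)) ℕ.+
                        indicator (Dec.does (crossing? S′ e))
      pointwise e with Dec.does (e ∈ˢ? D)
      ... | false = z≤n
      ... | true rewrite Vec.lookup-zipWith _∧_ (proj₁ (ends e)) S S′
                       | Vec.lookup-zipWith _∧_ (proj₂ (ends e)) S S′
                       | Vec.lookup-zipWith _∨_ (proj₁ (ends e)) S S′
                       | Vec.lookup-zipWith _∨_ (proj₂ (ends e)) S S′ =
        xor-submodular (Vec.lookup S (proj₁ (ends e))) (Vec.lookup S (proj₂ (ends e)))
                       (Vec.lookup S′ (proj₁ (ends e))) (Vec.lookup S′ (proj₂ (ends e)))

    cut-∁-≤ : ∀ S → cut (∁ S) ℕ.≤ cut S
    cut-∁-≤ S = unique-⊆-length (boundary-unique (∁ S)) λ e∈ →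
      let e∈D , s , t , j , s∈ , t∉ = boundary⁻ (∁ S) e∈ in
      boundary⁺ S e∈D (joins-sym j) (Subset.x∉∁p⇒x∈p t∉) (Subset.x∈∁p⇒x∉p s∈)

    record Tight (x y : V) (S : Subset order) : Set where
      constructor tight
      field
        inside  : x ∈ˢ S
        outside : y ∉ˢ S
        minimal : ∀ {S′} → x ∈ˢ S′ → y ∉ˢ S′ → cut S ℕ.≤ cut S′

    open Tight

    tight-cut : ∀ {x y} → x ≢ y → ∃ (Tight x y)
    tight-cut {x} {y} x≢y =
      descend (cut ⁅ x ⁆) ⁅ x ⁆ ℕ.≤-refl (Subset.x∈⁅x⁆ x) (x≢y ∘ sym ∘ Subset.x∈⁅y⁆⇒x≡y x)
      where
      descend : ∀ n S → cut S ℕ.≤ n → x ∈ˢ S → y ∉ˢ S → ∃ (Tight x y)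
      descend n S S≤n x∈ y∉
        with anySubset? (λ S′ → x ∈ˢ? S′ ×-dec ¬? (y ∈ˢ? S′) ×-dec cut S′ ℕ.<? cut S)
      descend n S S≤n x∈ y∉ | no ¬smaller =
        S , tight x∈ y∉ λ x∈′ y∉′ → ℕ.≮⇒≥ λ S′<S → ¬smaller (_ , x∈′ , y∉′ , S′<S)
      descend zero S S≤n x∈ y∉ | yes (_ , _ , _ , S′<S) =
        contradiction (ℕ.≤-trans S′<S S≤n) λ ()
      descend (suc n) S S≤n x∈ y∉ | yes (S′ , x∈′ , y∉′ , S′<S) =
        descend n S′ (ℕ.≤-pred (ℕ.≤-trans S′<S S≤n)) x∈′ y∉′

    tight-∁ : ∀ {x y S} → Tight x y S → Tight y x (∁ S)
    tight-∁ {S = S} (tight x∈ y∉ min) =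
      tight (Subset.x∉p⇒x∈∁p y∉) (Subset.x∈p⇒x∉∁p x∈) λ {S′} y∈′ x∉′ →
        ℕ.≤-trans (cut-∁-≤ S) (ℕ.≤-trans
          (min (Subset.x∉p⇒x∈∁p x∉′) (Subset.x∈p⇒x∉∁p y∈′)) (cut-∁-≤ S′))

    -- The union still separates `x` from `y`, so its cut is at least that of `S`; submodularity
    -- then bounds the cut of the intersection by that of `T`.
    uncross : ∀ {x y p q S T} → Tight x y S → Tight p q T → p ∈ˢ S → y ∉ˢ T → Tight p q (S ∩ T)
    uncross {S = S} {T} (tight x∈ y∉S min) (tight p∈T q∉T min′) p∈S y∉T =
      tight (Subset.x∈p∩q⁺ (p∈S , p∈T)) (q∉T ∘ proj₂ ∘ Subset.x∈p∩q⁻ S T) λ p∈′ q∉′ →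
        ℕ.≤-trans ∩≤T (min′ p∈′ q∉′)
      where
      S≤∪ : cut S ℕ.≤ cut (S ∪ T)
      S≤∪ = min (Subset.x∈p∪q⁺ (inj₁ x∈)) ([ y∉S , y∉T ]′ ∘ Subset.x∈p∪q⁻ S T)
      ∩≤T : cut (S ∩ T) ℕ.≤ cut T
      ∩≤T = ℕ.+-cancelˡ-≤ (cut S) _ _ (ℕ.≤-trans (ℕ.≤-reflexive (ℕ.+-comm (cut S) _))
              (ℕ.≤-trans (ℕ.+-monoʳ-≤ (cut (S ∩ T)) S≤∪) (submodular S T)))

    -- Among the tight cuts between two vertices of P, a smallest one has only one vertex of P
    -- inside: a tight cut between two vertices inside would uncross to a smaller one.
    lonely-tight-cut : ∀ {P : V → Set} → (∀ t → Dec (P t)) → ∀ {x y} → x ≢ y → P x → P y →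
      ∃₂ λ x y → P x × P y × ∃ λ S → Tight x y S × (∀ {z} → z ∈ˢ S → P z → z ≡ x)
    lonely-tight-cut {P} P? x≢y Px Py = let S , t = tight-cut x≢y in descend ∣ S ∣ ℕ.≤-refl Px Py t
      where
      descend : ∀ n {x y S} → ∣ S ∣ ℕ.≤ n → P x → P y → Tight x y S →
        ∃₂ λ x y → P x × P y × ∃ λ S → Tight x y S × (∀ {z} → z ∈ˢ S → P z → z ≡ x)
      descend n {x} {y} {S} S≤n Px Py t
        with Fin.any? (λ z → z ∈ˢ? S ×-dec P? z ×-dec ¬? (z Fin.≟ x))
      ... | no ¬z = x , y , Px , Py , S , t ,
        λ {z} z∈ Pz → decidable-stable (z Fin.≟ x) λ z≢x → ¬z (z , z∈ , Pz , z≢x)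
      descend zero {S = S} S≤n _ _ t | yes (z , z∈ , _) =
        contradiction (ℕ.≤-trans (x∈p⇒∣p-x∣<∣p∣ z∈) S≤n) λ ()
      descend (suc n) {x} {y} {S} S≤n Px Py t | yes (z , z∈ , Pz , z≢x)
        with tight-cut (z≢x ∘ sym)
      ... | T , t′ with y ∈ˢ? T
      ... | no y∉T = descend n (shrink z∈ (outside t′)) Px Pz (uncross t t′ (inside t) y∉T)
        where
        shrink : ∀ {z} → z ∈ˢ S → z ∉ˢ T → ∣ S ∩ T ∣ ℕ.≤ n
        shrink z∈ z∉ = ℕ.≤-pred (ℕ.≤-trans (Subset.p⊂q⇒∣p∣<∣q∣
          (Subset.p∩q⊆p S T , _ , z∈ , z∉ ∘ proj₂ ∘ Subset.x∈p∩q⁻ S T)) S≤n)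
      -- Here the complement of `T` takes the place of `T`, and `x` and `z` exchange roles; the new
      -- set is smaller because it loses `x`.
      ... | yes y∈T = descend n shrink Pz Px
        (uncross t (tight-∁ t′) z∈ (Subset.x∈p⇒x∉∁p y∈T))
        where
        shrink : ∣ S ∩ ∁ T ∣ ℕ.≤ n
        shrink = ℕ.≤-pred (ℕ.≤-trans (Subset.p⊂q⇒∣p∣<∣q∣ (Subset.p∩q⊆p S (∁ T) , x , inside t ,
          Subset.x∈p⇒x∉∁p (inside t′) ∘ proj₂ ∘ Subset.x∈p∩q⁻ S (∁ T))) S≤n)

module _ {n : ℕ} {P : Fin n → Set} (P? : ∀ x → Dec (P x)) where

  subset : Subset n
  subset = Vec.tabulate (Dec.does ∘ P?)

  subset⁺ : ∀ {x} → P x → x ∈ˢ subset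
  subset⁺ {x} Px = Vec.lookup⇒[]= x subset
    (trans (Vec.lookup∘tabulate (Dec.does ∘ P?) x) (dec-true (P? x) Px))

  subset⁻ : ∀ {x} → x ∈ˢ subset → P x
  subset⁻ {x} x∈ = decidable-stable (P? x) λ ¬Px →
    contradiction (trans (sym (Vec.[]=⇒lookup x∈))
      (trans (Vec.lookup∘tabulate (Dec.does ∘ P?) x) (dec-false (P? x) ¬Px))) λ ()

-- Critical graphs

module Criticality (H : Multigraph) where
  open Multigraph H
  open Line H
  open Cuts H

  record IsCritical (D : Subset size) (d : ℕ) : Set where
    field
      simple        : SimpleOn D
      degree≤       : ∀ t → degree D t ℕ.≤ d
      ¬colourable   : ¬ Colourable (line D) d
      colourable-   : ∀ {e} → e ∈ˢ D → Colourable (line (D - e)) d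

  degree-mono : ∀ {D D′ : Subset size} → D′ ⊆ˢ D → ∀ t → degree D′ t ℕ.≤ degree D t
  degree-mono {D} {D′} D′⊆D t = unique-⊆-length (star-unique D′ t) λ e∈ →
    let e∈D′ , t∈e = star⁻ e∈ in star⁺ (D′⊆D e∈D′) t∈e

  critical-subset : ∀ {D : Subset size} {d} → SimpleOn D → (∀ t → degree D t ℕ.≤ d) →
                    ¬ Colourable (line D) d → ∃ λ D′ → D′ ⊆ˢ D × IsCritical D′ d
  critical-subset {D} {d} simple deg ¬col = descend ∣ D ∣ D ℕ.≤-refl simple deg ¬col
    where
    descend : ∀ n (D : Subset size) → ∣ D ∣ ℕ.≤ n → SimpleOn D → (∀ t → degree D t ℕ.≤ d) →
              ¬ Colourable (line D) d → ∃ λ D′ → D′ ⊆ˢ D × IsCritical D′ d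
    descend n D D≤n simple deg ¬col
      with Fin.any? (λ e → e ∈ˢ? D ×-dec ¬? (colourable? (line (D - e)) d))
    ... | no ¬e = D , id , record
      { simple = simple ; degree≤ = deg ; ¬colourable = ¬col
      ; colourable- = λ {e} e∈ →
          decidable-stable (colourable? (line (D - e)) d) λ ¬col′ → ¬e (e , e∈ , ¬col′) }
    descend zero D D≤n _ _ _ | yes (e , e∈ , _) =
      contradiction (ℕ.≤-trans (x∈p⇒∣p-x∣<∣p∣ e∈) D≤n) λ ()
    descend (suc n) D D≤n simple deg ¬col | yes (e , e∈ , ¬col′) =
      let D′ , D′⊆ , crit = descend n (D - e)
            (ℕ.≤-pred (ℕ.≤-trans (x∈p⇒∣p-x∣<∣p∣ e∈) D≤n))
            (λ e∈ f∈ → simple (remove-⊆ D e∈) (remove-⊆ D f∈))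
            (λ t → ℕ.≤-trans (degree-mono (remove-⊆ D) t) (deg t)) ¬col′
      in D′ , remove-⊆ D ∘ D′⊆ , crit

  module _ {D : Subset size} {d : ℕ} (critical : IsCritical D d) where
    open IsCritical critical

    Full : V → Set
    Full t = d ℕ.≤ degree D t

    full? : ∀ t → Dec (Full t)
    full? t = d ℕ.≤? degree D t

    degree-remove : ∀ {e t} → e ∈ˢ D → Incident t e → degree (D - e) t ℕ.< degree D t
    degree-remove {e} {t} e∈ t∈e = unique-⊆-length
      (∉⇒All≢ (λ e∈′ → x∉p-x D e (proj₁ (star⁻ e∈′))) ∷ star-unique (D - e) t)
      λ { (here refl) → star⁺ e∈ t∈e
        ; (there f∈) → let f∈D , t∈f = star⁻ f∈ in star⁺ (remove-⊆ D f∈D) t∈f }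

    -- Vizing's adjacency lemma. Without such an `f`, after the deletion of `e` a colour would be
    -- missing at `u` and at every far end: the ends of `e` have lost an edge, and the other far
    -- ends have degree less than d. The fan argument would then colour all of `D`.
    full-neighbour : ∀ {e u} → e ∈ˢ D → Incident u e →
                     ∃ λ f → f ∈ˢ D × f ≢ e × Incident u f × Full (far u f)
    full-neighbour {e} {u} e∈ u∈e
      with Fin.any? (λ f → f ∈ˢ? D ×-dec ¬? (f Fin.≟ e) ×-dec incident? u f ×-dec full? (far u f))
    ... | yes found = found
    ... | no ¬found =
      contradiction (vizing (proper (proj₂ colouring)) (missing (less u∈e)) free) ¬colourable
      where
      open Fan D simple e∈ u∈e
      colouring = colourable- e∈
      c = proj₁ colouring
      proper : IsColouring (line (D - e)) c → Proper c
      proper p f∈ g∈ f≢g t∈f t∈g = p _ _ (f∈ , g∈ , f≢g , _ , t∈f , t∈g)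
      missing : ∀ {t} → degree (D - e) t ℕ.< d → ∃ λ γ → Misses c t γ
      missing {t} lt = let γ , free = free-colour c (star (D - e) t) lt in
        γ , λ f∈ t∈f → free (star⁺ f∈ t∈f)
      less : ∀ {t} → Incident t e → degree (D - e) t ℕ.< d
      less {t} t∈e = ℕ.≤-trans (degree-remove e∈ t∈e) (degree≤ t)
      free : ∀ {f} → f ∈ˢ D → Incident u f → ∃ λ γ → Misses c (far u f) γ
      free {f} f∈ u∈f with f Fin.≟ e
      ... | yes refl = missing (less (joins-incident (joins-sym (incident⇒joins u∈f))))
      ... | no  f≢e  = missing (ℕ.≤-<-trans (degree-mono (remove-⊆ D) (far u f))
        (ℕ.≰⇒> λ full → ¬found (f , f∈ , f≢e , u∈f , full)))

    two-full : ∀ {e} → e ∈ˢ D → ∃₂ λ x y → x ≢ y × Full x × Full y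
    two-full {e} e∈ with f , f∈ , _ , u∈f , full ← full-neighbour e∈ (inj₁ refl)
                    with g , g∈ , g≢f , u∈g , full′ ← full-neighbour f∈ u∈f =
      _ , _ , (λ eq → g≢f (simple g∈ f∈ (incident⇒joins u∈g)
        (subst (λ t → Joins _ t f) eq (incident⇒joins u∈f)))) , full , full′

    open Cut D

    -- Every edge at x leaves S, or is continued inside S by an edge to a second full vertex,
    -- which leaves S.
    lonely-cut-large : ∀ {x S} → x ∈ˢ S → Full x → (∀ {z} → z ∈ˢ S → Full z → z ≡ x) → d ℕ.≤ cut S
    lonely-cut-large {x} {S} x∈ full lonely =
      ℕ.≤-trans full (injection-length exit-injective (proj₁ ∘ proj₂ ∘ exits))
      where
      -- The cut edge `g` determines its end `r` in `S`, and `r` determines `e`: it is `g` itself if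
      -- `r` is `x`, and otherwise the only edge from `x` to `r`. This makes the charging injective.
      record Exit (e g : E) (r : V) : Set where
        field
          inner : r ∈ˢ S
          at    : Incident r g
          shape : (r ≡ x × g ≡ e) ⊎ (Joins x r e)
      exit : ∀ {e} → e ∈ˢ D → Incident x e → ∃ λ g → g ∈ boundary S × ∃ (Exit e g)
      exit {e} e∈ x∈e with far x e ∈ˢ? S
      ... | no y∉ = e , boundary⁺ S e∈ (incident⇒joins x∈e) x∈ y∉ , x ,
        record { inner = x∈ ; at = x∈e ; shape = inj₁ (refl , refl) }
      ... | yes y∈ with full-neighbour e∈ (joins-incident (joins-sym (incident⇒joins x∈e)))
      ... | g , g∈ , g≢e , y∈g , full′ = g , boundary⁺ S g∈ (incident⇒joins y∈g) y∈ z∉ , far x e ,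
        record { inner = y∈ ; at = y∈g ; shape = inj₂ (incident⇒joins x∈e) }
        where
        -- Inside `S` this end would have to be `x`, and `g` would be parallel to `e`.
        z∉ : far (far x e) g ∉ˢ S
        z∉ z∈ = g≢e (simple g∈ e∈
          (subst (λ t → Joins (far x e) t g) (lonely z∈ full′) (incident⇒joins y∈g))
          (joins-sym (incident⇒joins x∈e)))
      exits : ∀ i → let e = lookup (star D x) i in ∃ λ g → g ∈ boundary S × ∃ (Exit e g)
      exits i = let e∈ , x∈e = star⁻ {D} {x} (∈-lookup i) in exit e∈ x∈e
      same : ∀ {e f g r s} → g ∈ boundary S → e ∈ˢ D → f ∈ˢ D →
             Exit e g r → Exit f g s → e ≡ f
      same g∈ e∈ f∈ E₁ E₂
        with refl ← inner-end-unique {S} g∈ (Exit.at E₁) (Exit.at E₂) (Exit.inner E₁) (Exit.inner E₂)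
        with Exit.shape E₁ | Exit.shape E₂
      ... | inj₁ (_ , g≡e)  | inj₁ (_ , g≡f)  = trans (sym g≡e) g≡f
      ... | inj₁ (refl , _) | inj₂ j          = contradiction refl (joins-≢ j)
      ... | inj₂ j          | inj₁ (refl , _) = contradiction refl (joins-≢ j)
      ... | inj₂ j          | inj₂ j′         = simple e∈ f∈ j j′
      exit-injective : Injective _≡_ _≡_ (proj₁ ∘ exits)
      exit-injective {i} {j} eq = lookup-unique (star-unique D x)
        (same (proj₁ (proj₂ (exits i))) (proj₁ (star⁻ {D} {x} (∈-lookup i)))
          (proj₁ (star⁻ {D} {x} (∈-lookup j))) (proj₂ (proj₂ (proj₂ (exits i))))
          (subst (λ g → Exit _ g (proj₁ (proj₂ (proj₂ (exits j))))) (sym eq)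
            (proj₂ (proj₂ (proj₂ (exits j))))))

    open Graph (line D) using (Adj; adj?; adj-sym; adj-irrefl)

    Adj? : (ef : E × E) → Dec (Adj (proj₁ ef) (proj₂ ef))
    Adj? (e , f) = adj? e f

    pairs adjacencies : List (E × E)
    pairs = cartesianProduct (allFin size) (allFin size)
    adjacencies = filter Adj? pairs

    open Menger {A = E} Fin._≟_

    arc⁺ : ∀ {e f} → Adj e f → Arc Fin._≟_ adjacencies e f
    arc⁺ ef = ∈-filter⁺ Adj? (∈-cartesianProduct⁺ (∈-allFin _) (∈-allFin _)) ef

    arc⁻ : ∀ {e f} → Arc Fin._≟_ adjacencies e f → Adj e f
    arc⁻ ef∈ = proj₂ (∈-filter⁻ Adj? {xs = pairs} ef∈)

    -- `S` consists of the vertices reachable from `x` by edges of `D` outside `X`, so an edge that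
    -- leaves `S` must be in `X`.
    separator-cut : ∀ {x y X} → x ≢ y → Separates adjacencies (star D x) (star D y) X →
                    ∃ λ S → x ∈ˢ S × y ∉ˢ S × cut S ℕ.≤ length X
    separator-cut {x} {y} {X} x≢y sep = S , subset⁺ C? ε , avoid ∘ subset⁻ C? ,
      unique-⊆-length (boundary-unique S) boundary⊆X
      where
      open DecMembership (Fin._≟_ {size}) using (_∈?_)
      R : Rel V 0ℓ
      R t s = ∃ λ e → e ∈ˢ D × e ∉ X × Joins t s e
      C? : ∀ t → Dec (Star R x t)
      C? = reachable? (λ t s → Fin.any? λ e → e ∈ˢ? D ×-dec ¬? (e ∈? X) ×-dec joins? t s e) x
      S : Subset order
      S = subset C?
      follow : ∀ {t e} → e ∈ˢ D → e ∉ X → Incident t e → Star R t y →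
               ∃ λ f → f ∈ star D y × ∃ λ (w : Star (Arc Fin._≟_ adjacencies) e f) →
               ∀ {z} → z ∈ support w → z ∉ X
      follow {e = e} e∈ e∉ t∈e ε = e , star⁺ e∈ t∈e , ε , λ { (here refl) → e∉ }
      follow {e = e} e∈ e∉ t∈e ((g , g∈ , g∉ , j) ◅ w)
        with follow g∈ g∉ (joins-incident (joins-sym j)) w | e Fin.≟ g
      -- A walk in `H` may use an edge twice in a row, which is no step in the line graph.
      ... | found | yes refl = found
      ... | f , f∈ , w′ , avoids | no e≢g =
        f , f∈ , arc⁺ (e∈ , g∈ , e≢g , _ , t∈e , joins-incident j) ◅ w′ ,
        λ { (here refl) → e∉ ; (there z∈) → avoids z∈ }
      avoid : ¬ Star R x y
      avoid ε = x≢y refl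
      avoid w@((e , e∈ , e∉ , j) ◅ _) =
        let f , f∈ , w′ , avoids = follow e∈ e∉ (joins-incident j) w
            z , z∈X , z∈w        = sep (star⁺ e∈ (joins-incident j)) f∈ w′
        in avoids z∈w z∈X
      boundary⊆X : boundary S ⊆ X
      boundary⊆X {e} e∈ with e∈D , s , t , j , s∈ , t∉ ← boundary⁻ S e∈ =
        decidable-stable (e ∈? X) λ e∉ →
          t∉ (subset⁺ C? (subset⁻ C? s∈ ◅◅ (e , e∈D , e∉ , j) ◅ ε))

    linked-stars : ∀ {e} → e ∈ˢ D → ∃₂ λ x y → x ≢ y × Full x × Full y ×
                   Linkage adjacencies (star D x) (star D y) d
    linked-stars e∈ with two-full e∈
    ... | _ , _ , x≢y , full , full′ with lonely-tight-cut full? x≢y full full′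
    ... | x , y , full-x , full-y , S , tight x∈ y∉ min , lonely
        with menger adjacencies (star D x) (star D y) d
    ... | inj₁ L = x , y , (λ { refl → y∉ x∈ }) , full-x , full-y , L
    ... | inj₂ (X , X<d , sep) =
      let S′ , x∈′ , y∉′ , S′≤X = separator-cut (λ { refl → y∉ x∈ }) sep
      in contradiction X<d (ℕ.≤⇒≯ (ℕ.≤-trans (lonely-cut-large x∈ full-x lonely)
                                    (ℕ.≤-trans (min x∈′ y∉′) S′≤X)))

-- Immersions in line graphs of critical graphs

exception : ∀ {d} {P : Fin d → Set} → 2 ℕ.≤ d → (∀ i → Dec (P i)) →
            (∀ {i j} → P i → P j → i ≡ j) → ∃ λ i → ¬ P i
exception (s≤s (s≤s _)) P? unique with P? zero | P? (suc zero)
... | no ¬P₀ | _      = zero , ¬P₀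
... | yes _  | no ¬P₁ = suc zero , ¬P₁
... | yes P₀ | yes P₁ = contradiction (unique P₀ P₁) λ ()

module CriticalImmersion (H : Multigraph) where
  open Multigraph H
  open Line H
  open Criticality H

  module _ {D : Subset size} {d : ℕ} (critical : IsCritical D d) where
    open IsCritical critical
    open Graph (line D) using (Adj; adj?; adj-sym; adj-irrefl)

    neighbours : E → List E
    neighbours b = filter (adj? b) (allFin size)

    neighbours⁻ : ∀ {b z} → z ∈ neighbours b → Adj b z
    neighbours⁻ {b} z∈ = proj₂ (∈-filter⁻ (adj? b) {xs = allFin size} z∈)

    few-neighbours : ∀ {b} → b ∈ˢ D → length (neighbours b) ℕ.≤ d →
                     ContainsTotallyOddStrongImmersion (line D) (complete (suc d))
    few-neighbours {b} b∈ few = low-degree-immersion (line D) b (neighbours b)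
      (λ bx → ∈-filter⁺ (adj? b) (∈-allFin _) bx) few (proj₁ colouring)
      (λ x≢b y≢b (x∈ , y∈ , xy) → proj₂ colouring _ _
        (x∈p∧x≢y⇒x∈p-y x∈ x≢b , x∈p∧x≢y⇒x∈p-y y∈ y≢b , xy))
      ¬colourable
      where colouring = colourable- b∈

    -- The terminals are all edges at y and one edge f at x.
    module Spokes (many : ∀ {b} → b ∈ˢ D → d ℕ.< length (neighbours b)) {x y : V} (x≢y : x ≢ y)
                  (L : Menger.Linkage Fin._≟_ (adjacencies critical) (star D x) (star D y) d)
                  (2≤d : 2 ℕ.≤ d) where
      open Menger.Linkage L renaming (simple to walk-simple)

      link-walk : ∀ i → Star Adj (start i) (end i)
      link-walk i = Star.map (arc⁻ critical) (walk i)

      Trail : Fin d → List E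
      Trail i = support (link-walk i)

      trail-unique : ∀ i → Unique (Trail i)
      trail-unique i = subst Unique (sym (support-map (arc⁻ critical) (walk i))) (walk-simple i)

      trail-disjoint : ∀ {i j z} → z ∈ Trail i → z ∈ Trail j → i ≡ j
      trail-disjoint {i} {j} z∈ z∈′ =
        disjoint (subst (_ ∈_) (support-map (arc⁻ critical) (walk i)) z∈)
                 (subst (_ ∈_) (support-map (arc⁻ critical) (walk j)) z∈′)

      end-covers : ∀ {z} → z ∈ star D y → ∃ λ i → end i ≡ z
      end-covers = injection-covers Fin._≟_ end-injective end∈ (degree≤ y)

      end-in-trail : ∀ {i j} → end j ∈ Trail i → j ≡ i
      end-in-trail {j = j} b∈ = trail-disjoint (end∈support (link-walk j)) b∈

      -- A trail with equal ends is an edge between `x` and `y`, and simplicity allows only one of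
      -- these. The start of any other trail is not at `y`, so it is a new terminal.
      centre : ∃ λ i → start i ≢ end i
      centre = exception 2≤d (λ i → start i Fin.≟ end i) λ {i} {j} e e′ →
        start-injective (simple (proj₁ (star⁻ {D} (start∈ i))) (proj₁ (star⁻ {D} (start∈ j)))
                                (both i e) (both j e′))
        where
        both : ∀ i → start i ≡ end i → Joins x y (start i)
        both i e = incident-two (proj₂ (star⁻ {D} (start∈ i)))
          (subst (Incident y) (sym e) (proj₂ (star⁻ {D} (end∈ i)))) x≢y

      i₀ : Fin d
      i₀ = proj₁ centre

      f : E
      f = start i₀

      f∉ : f ∉ star D y
      f∉ f∈ with j , eq ← end-covers f∈
        with refl ← trail-disjoint (subst (_∈ Trail j) eq (end∈support (link-walk j)))
                                   (start∈support (link-walk i₀)) = proj₂ centre (sym eq)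

      f≢end : ∀ {i} → f ≢ end i
      f≢end {i} f≡ = f∉ (subst (_∈ star D y) (sym f≡) (end∈ i))

      _∈⁺_ : E → Fin d → Set
      z ∈⁺ i = z ≡ f ⊎ z ∈ Trail i

      ∈⁺-off : ∀ {i z} → z ≢ f → z ∈⁺ i → z ∈ Trail i
      ∈⁺-off z≢f (inj₁ z≡f) = contradiction z≡f z≢f
      ∈⁺-off z≢f (inj₂ z∈)  = z∈

      ∈⁺-disjoint : ∀ {i j z} → z ≢ f → z ∈⁺ i → z ∈⁺ j → i ≡ j
      ∈⁺-disjoint z≢f z∈ z∈′ = trail-disjoint (∈⁺-off z≢f z∈) (∈⁺-off z≢f z∈′)

      ∈⁺-star : ∀ {i z} → z ∈⁺ i → z ∈ star D y → z ≡ end i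
      ∈⁺-star (inj₁ refl) z∈y = contradiction z∈y f∉
      ∈⁺-star (inj₂ z∈) z∈y with j , refl ← end-covers z∈y = cong end (end-in-trail z∈)

      approach : ∀ i → ∃ λ (w : Star Adj f (end i)) →
                 Unique (support w) × (∀ {z} → z ∈ support w → z ∈⁺ i)
      approach i with i Fin.≟ i₀
      ... | yes refl = link-walk i , trail-unique i , inj₂
      ... | no i≢i₀  = fa ◅ link-walk i ,
        ∉⇒All≢ (λ f∈ → i≢i₀ (trail-disjoint f∈ (start∈support (link-walk i₀)))) ∷ trail-unique i ,
        λ { (here z≡f) → inj₁ z≡f ; (there z∈) → inj₂ z∈ }
        where
        fa : Adj f (start i)
        fa = proj₁ (star⁻ {D} (start∈ i₀)) , proj₁ (star⁻ {D} (start∈ i)) ,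
             (i≢i₀ ∘ sym ∘ start-injective) , x ,
             proj₂ (star⁻ {D} (start∈ i₀)) , proj₂ (star⁻ {D} (start∈ i))

      tip : Fin d → V
      tip i = far y (end i)

      end-joins : ∀ i → Joins y (tip i) (end i)
      end-joins i = incident⇒joins (proj₂ (star⁻ {D} (end∈ i)))

      AtTip : Fin d → E → Set
      AtTip i z = z ∈ˢ D × Incident (tip i) z × z ≢ end i

      at-tip? : ∀ i z → Dec (AtTip i z)
      at-tip? i z = z ∈ˢ? D ×-dec incident? (tip i) z ×-dec ¬? (z Fin.≟ end i)

      at-tip∉ : ∀ {i z} → AtTip i z → z ∉ star D y
      at-tip∉ {i} (z∈ , t∈z , z≢) z∈y = z≢ (simple z∈ (proj₁ (star⁻ {D} (end∈ i)))
        (incident-two (proj₂ (star⁻ {D} z∈y)) t∈z (joins-≢ (end-joins i))) (end-joins i))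

      at-tip-adj : ∀ {i z} → AtTip i z → Adj z (end i)
      at-tip-adj {i} (z∈ , t∈z , z≢) =
        z∈ , proj₁ (star⁻ {D} (end∈ i)) , z≢ , tip i , t∈z , joins-incident (joins-sym (end-joins i))

      adj-end : ∀ {i z} → Adj z (end i) → z ∈ star D y ⊎ AtTip i z
      adj-end {i} (z∈ , _ , z≢ , t , t∈z , t∈b) with joins-ends (end-joins i) t∈b
      ... | inj₁ refl = inj₁ (star⁺ z∈ t∈z)
      ... | inj₂ refl = inj₂ (z∈ , t∈z , z≢)

      -- The only edge at `y` on the approach is `end i` itself, so the last step comes from the
      -- other end of that edge.
      enters-at-tip : ∀ i → ∃ λ p → p ∈ support (proj₁ (approach i)) × AtTip i p
      enters-at-tip i with w , _ , ⊆⁺ ← approach i with last-step w f≢end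
      ... | p , p∈ , pb with adj-end pb
      ... | inj₂ at  = p , p∈ , at
      ... | inj₁ p∈y = contradiction pb (adj-irrefl (∈⁺-star (⊆⁺ p∈) p∈y))

      -- The edges at a tip are pairwise adjacent in the line graph, so that a detour through
      -- a second one corrects the parity of a spoke.
      second-at-tip : ∀ i q → ∃ λ q′ → AtTip i q′ × q′ ≢ q
      second-at-tip i q with Fin.any? (λ q′ → at-tip? i q′ ×-dec ¬? (q′ Fin.≟ q))
      ... | yes found = found
      -- Otherwise `end i` and its neighbours would all occur in `q ∷ star D y`, which leaves at
      -- most d neighbours.
      ... | no ¬found = contradiction (many (proj₁ (star⁻ {D} (end∈ i))))
        (ℕ.≤⇒≯ (ℕ.≤-trans (ℕ.≤-pred (unique-⊆-length
          (∉⇒All≢ (adj-irrefl refl ∘ neighbours⁻) ∷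
           Unique.filter⁺ (adj? (end i)) (Unique.allFin⁺ size))
          covered)) (degree≤ y)))
        where
        covered : end i ∷ neighbours (end i) ⊆ q ∷ star D y
        covered (here refl) = there (end∈ i)
        covered (there z∈) with adj-end (adj-sym (neighbours⁻ z∈))
        ... | inj₁ z∈y = there z∈y
        ... | inj₂ at  = here (decidable-stable (_ Fin.≟ q) λ z≢q → ¬found (_ , at , z≢q))

      -- A detour may visit a vertex of another spoke, so each kind of step records what identifies
      -- `i`: two vertices of the spoke, of which at most one is `f`; a vertex of the trail other
      -- than `f`; or the final vertex `end i`. In `final`, the condition on `z` excludes the edges
      -- between terminals at `y`.
      data Own (i : Fin d) (z z′ : E) : Set where
        chain  : z ∈⁺ i → z′ ∈⁺ i → z ≢ z′ → Own i z z′
        detour : z ∈ Trail i → z ≢ f → z ≢ z′ → AtTip i z → AtTip i z′ → Own i z z′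
        final  : z ∉ star D y → z′ ≡ end i → Own i z z′

      -- Different trails extended by `f` share only `f`, and a step has an end other than `f`.
      chain-clash : ∀ {i j z z′} → z ∈⁺ i → z′ ∈⁺ i → z ≢ z′ → Own j z z′ → i ≡ j
      chain-clash {z = z} z∈ z′∈ z≢z′ (chain z∈′ z′∈′ _) with z Fin.≟ f
      ... | no  z≢f  = ∈⁺-disjoint z≢f z∈ z∈′
      ... | yes refl = ∈⁺-disjoint (z≢z′ ∘ sym) z′∈ z′∈′
      chain-clash z∈ _ _ (detour z∈′ z≢f _ _ _) = ∈⁺-disjoint z≢f z∈ (inj₂ z∈′)
      chain-clash _ z′∈ _ (final _ refl) = sym (end-in-trail (∈⁺-off (f≢end ∘ sym) z′∈))

      final-clash : ∀ {i j z z′} → z ∉ star D y → z′ ≡ end i → Own j z z′ ⊎ Own j z′ z → i ≡ j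
      final-clash z∉ refl (inj₁ (chain z∈ z′∈ z≢)) = sym (chain-clash z∈ z′∈ z≢ (final z∉ refl))
      final-clash z∉ refl (inj₂ (chain z′∈ z∈ z≢)) =
        sym (chain-clash z∈ z′∈ (z≢ ∘ sym) (final z∉ refl))
      final-clash {i} z∉ refl (inj₁ (detour _ _ _ _ at)) = contradiction (end∈ i) (at-tip∉ at)
      final-clash {i} z∉ refl (inj₂ (detour _ _ _ at _)) = contradiction (end∈ i) (at-tip∉ at)
      final-clash z∉ refl (inj₁ (final _ e)) = end-injective e
      final-clash {i} z∉ refl (inj₂ (final e∉ _)) = contradiction (end∈ i) e∉

      own-clash : ∀ {i j z z′} → Own i z z′ → Own j z z′ → i ≡ j
      own-clash (chain z∈ z′∈ z≢) o = chain-clash z∈ z′∈ z≢ o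
      own-clash (final z∉ e) o = final-clash z∉ e (inj₁ o)
      own-clash o@(detour _ _ _ _ _) (chain z∈ z′∈ z≢) = sym (chain-clash z∈ z′∈ z≢ o)
      own-clash o@(detour _ _ _ _ _) (final z∉ e) = sym (final-clash z∉ e (inj₁ o))
      own-clash (detour z∈ _ _ _ _) (detour z∈′ _ _ _ _) = trail-disjoint z∈ z∈′

      -- Two detours through the same adjacent pair have the same tip, by simplicity.
      own-clash-sym : ∀ {i j z z′} → Own i z z′ → Own j z′ z → i ≡ j
      own-clash-sym (chain z∈ z′∈ z≢) o = chain-clash z′∈ z∈ (z≢ ∘ sym) o
      own-clash-sym (final z∉ e) o = final-clash z∉ e (inj₂ o)
      own-clash-sym o@(detour _ _ _ _ _) (chain z′∈ z∈ z≢) =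
        sym (chain-clash z∈ z′∈ (z≢ ∘ sym) o)
      own-clash-sym o@(detour _ _ _ _ _) (final z′∉ e) = sym (final-clash z′∉ e (inj₂ o))
      own-clash-sym {i} {j} (detour _ _ z≢ (z∈ , t∈z , _) (z′∈ , t∈z′ , _))
                            (detour _ _ _ (_ , s∈z′ , _) (_ , s∈z , _)) with tip i Fin.≟ tip j
      ... | no  t≢s = contradiction (simple z∈ z′∈ (incident-two t∈z s∈z t≢s)
                                                   (incident-two t∈z′ s∈z′ t≢s)) z≢
      ... | yes t≡s = end-injective (simple (proj₁ (star⁻ {D} (end∈ i))) (proj₁ (star⁻ {D} (end∈ j)))
                        (end-joins i) (subst (λ t → Joins y t _) (sym t≡s) (end-joins j)))

      own-not-rim : ∀ {i z z′} → Own i z z′ → z ∈ star D y → z′ ∈ star D y → ⊥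
      own-not-rim (chain z∈ z′∈ z≢) z∈y z′∈y =
        z≢ (trans (∈⁺-star z∈ z∈y) (sym (∈⁺-star z′∈ z′∈y)))
      own-not-rim (detour _ _ _ at _) z∈y _ = at-tip∉ at z∈y
      own-not-rim (final z∉ _) z∈y _ = z∉ z∈y

      φ : Fin (suc d) → E
      φ zero    = f
      φ (suc i) = end i

      φ-injective : Injective _≡_ _≡_ φ
      φ-injective {zero}  {zero}  _ = refl
      φ-injective {zero}  {suc j} e = contradiction e f≢end
      φ-injective {suc i} {zero}  e = contradiction (sym e) f≢end
      φ-injective {suc i} {suc j} e = cong suc (end-injective e)

      Owned : Fin (suc d) → Fin (suc d) → Rel E 0ℓ
      Owned zero    (suc i) z z′ = Own i z z′ ⊎ Own i z′ z
      Owned (suc i) (suc j) z z′ = Pair end i j z z′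
      Owned _       zero    _ _  = ⊥

      owned-sym : ∀ {p q z z′} → Owned p q z z′ → Owned p q z′ z
      owned-sym {zero}  {suc i} (inj₁ o) = inj₂ o
      owned-sym {zero}  {suc i} (inj₂ o) = inj₁ o
      owned-sym {suc i} {suc j} o        = pair-sym o
      owned-sym {zero}  {zero}  ()
      owned-sym {suc i} {zero}  ()

      spoke-rim : ∀ {i j k z z′} → Own i z z′ ⊎ Own i z′ z → ¬ Pair end j k z z′
      spoke-rim {j = j} {k} (inj₁ o) straight = own-not-rim o (end∈ j) (end∈ k)
      spoke-rim {j = j} {k} (inj₁ o) reversed = own-not-rim o (end∈ k) (end∈ j)
      spoke-rim {j = j} {k} (inj₂ o) straight = own-not-rim o (end∈ k) (end∈ j)
      spoke-rim {j = j} {k} (inj₂ o) reversed = own-not-rim o (end∈ j) (end∈ k)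

      owned-unique : ∀ {p q p′ q′ z z′} → p Fin.< q → p′ Fin.< q′ →
                     Owned p q z z′ → Owned p′ q′ z z′ → p ≡ p′ × q ≡ q′
      owned-unique {zero} {suc i} {zero} {suc j} _ _ o o′ = refl , cong suc (clash o o′)
        where
        clash : ∀ {z z′} → Own i z z′ ⊎ Own i z′ z → Own j z z′ ⊎ Own j z′ z → i ≡ j
        clash (inj₁ o) (inj₁ o′) = own-clash o o′
        clash (inj₁ o) (inj₂ o′) = own-clash-sym o o′
        clash (inj₂ o) (inj₁ o′) = own-clash-sym o o′
        clash (inj₂ o) (inj₂ o′) = own-clash o o′
      owned-unique {zero} {suc i} {suc j} {suc k} _ _ o o′ = contradiction o′ (spoke-rim o)
      owned-unique {suc j} {suc k} {zero} {suc i} _ _ o o′ = contradiction o (spoke-rim o′)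
      owned-unique {suc i} {suc j} {suc k} {suc l} (s≤s i<j) (s≤s k<l) o o′ =
        let e , e′ = pair-unique end-injective i<j k<l o o′ refl refl in cong suc e , cong suc e′

      module _ {i q} (w₁ : Star Adj f q) (unique₁ : Unique (support w₁))
               (⊆⁺₁ : ∀ {z} → z ∈ support w₁ → z ∈⁺ i) (end∉ : end i ∉ support w₁) (at-q : AtTip i q)
               (only-q : ∀ {z} → z ∈ support w₁ → AtTip i z → z ≡ q) where

        owned₁ : ∀ {z z′} → (z , z′) ∈ arcs w₁ → Owned zero (suc i) z z′
        owned₁ zz′∈ = let z∈ , z′∈ = arcs-support w₁ zz′∈ in
          inj₁ (chain (⊆⁺₁ z∈) (⊆⁺₁ z′∈) λ z≡z′ → adj-irrefl z≡z′ (arcs-related w₁ zz′∈))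

        avoids₁ : ∀ {r} → φ r ∈ support w₁ → φ r ≡ f ⊎ φ r ≡ end i
        avoids₁ {zero}  _  = inj₁ refl
        avoids₁ {suc j} b∈ = inj₂ (∈⁺-star (⊆⁺₁ b∈) (end∈ j))

        -- From `q` the terminal `end i` is reached in one step or, through `q′`, in two. The vertex
        -- `q′` is new, as `w₁` has no edge at the tip besides `q`, and it is no terminal at `y`.
        spoke-of-parity : ∀ π → parity (length (arcs w₁)) ≡ π →
                          Link (line D) φ (Owned zero (suc i)) f (end i)
        spoke-of-parity 0ℙ even = record
          { walk   = w₁ ◅◅ qb
          ; simple = unique-◅◅ w₁ qb unique₁
              ((adj-irrefl-≢ (at-tip-adj at-q) ∷ []) ∷ [] ∷ [])
              λ { _ (here e) → e ; b∈ (there (here refl)) → contradiction b∈ end∉ }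
          ; odd    = trans (cong parity (trans (length-arcs-◅◅ w₁ qb) (ℕ.+-comm _ 1)))
                       (trans (parity-suc (length (arcs w₁))) (cong _⁻¹ even))
          ; owned  = λ zz′∈ → [ owned₁ , (λ { (here refl) → inj₁ (final (at-tip∉ at-q) refl) }) ]′
                       (arcs-◅◅ w₁ qb zz′∈)
          ; avoids = λ {r} r∈ → [ avoids₁ {r} , avoids₂ {r} ]′ (support-◅◅ w₁ qb r∈)
          }
          where
          adj-irrefl-≢ : ∀ {z z′} → Adj z z′ → z ≢ z′
          adj-irrefl-≢ zz′ z≡z′ = adj-irrefl z≡z′ zz′
          qb : Star Adj q (end i)
          qb = at-tip-adj at-q ◅ ε
          avoids₂ : ∀ {r} → φ r ∈ support qb → φ r ≡ f ⊎ φ r ≡ end i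
          avoids₂ {r} (here e)         = avoids₁ {r} (subst (_∈ support w₁) (sym e) (end∈support w₁))
          avoids₂     (there (here e)) = inj₂ e
        spoke-of-parity 1ℙ odd with second-at-tip i q
        ... | q′ , at-q′ , q′≢q = record
          { walk   = w₁ ◅◅ qq′b
          ; simple = unique-◅◅ w₁ qq′b unique₁
              (((q′≢q ∘ sym) ∷ proj₂ (proj₂ at-q) ∷ []) ∷ (proj₂ (proj₂ at-q′) ∷ []) ∷ [] ∷ [])
              λ { _ (here e) → e
                ; q′∈ (there (here refl)) → contradiction (only-q q′∈ at-q′) q′≢q
                ; b∈ (there (there (here refl))) → contradiction b∈ end∉ }
          ; odd    = trans (cong parity (trans (length-arcs-◅◅ w₁ qq′b) (ℕ.+-comm _ 2))) odd
          ; owned  = λ zz′∈ → [ owned₁ , owned₂ ]′ (arcs-◅◅ w₁ qq′b zz′∈)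
          ; avoids = λ {r} r∈ → [ avoids₁ {r} , avoids₂ {r} ]′ (support-◅◅ w₁ qq′b r∈)
          }
          where
          qq′b : Star Adj q (end i)
          qq′b = (proj₁ at-q , proj₁ at-q′ , (q′≢q ∘ sym) , tip i ,
                  proj₁ (proj₂ at-q) , proj₁ (proj₂ at-q′)) ◅ at-tip-adj at-q′ ◅ ε
          -- A simple walk from `f` to `f` is empty and hence even.
          q≢f : q ≢ f
          q≢f q≡f = contradiction (trans (sym odd) (cong parity
            (closed-walk-empty w₁ unique₁ (sym q≡f)))) λ ()
          q∈ : q ∈ Trail i
          q∈ = ∈⁺-off q≢f (⊆⁺₁ (end∈support w₁))
          owned₂ : ∀ {z z′} → (z , z′) ∈ arcs qq′b → Owned zero (suc i) z z′
          owned₂ (here refl)         = inj₁ (detour q∈ q≢f (q′≢q ∘ sym) at-q at-q′)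
          owned₂ (there (here refl)) = inj₁ (final (at-tip∉ at-q′) refl)
          avoids₂ : ∀ {r} → φ r ∈ support qq′b → φ r ≡ f ⊎ φ r ≡ end i
          avoids₂ {r} (here e) = avoids₁ {r} (subst (_∈ support w₁) (sym e) (end∈support w₁))
          avoids₂ {zero} (there (here _)) = inj₁ refl
          avoids₂ {suc j} (there (here e)) =
            contradiction (subst (_∈ star D y) e (end∈ j)) (at-tip∉ at-q′)
          avoids₂ (there (there (here e))) = inj₂ e

      spoke : ∀ i → Link (line D) φ (Owned zero (suc i)) f (end i)
      spoke i =
        let w , w-unique , ⊆⁺ = approach i
            _ , p∈ , at-p     = enters-at-tip i
            _ , at-q , w₁ , unique₁ , w₁⊆w , end∉ , only-q =
              first-hit (at-tip? i) w w-unique (λ (_ , _ , b≢b) → b≢b refl) p∈ at-p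
        in spoke-of-parity w₁ unique₁ (⊆⁺ ∘ w₁⊆w) end∉ at-q only-q _ refl

      spokes-immersion : ContainsTotallyOddStrongImmersion (line D) (complete (suc d))
      spokes-immersion = immersion (line D) φ φ-injective Owned
        (λ {p} {q} → owned-sym {p} {q}) (λ {p} {q} {p′} {q′} → owned-unique {p} {q} {p′} {q′}) link
        where
        link : ∀ {p q} → p Fin.< q → Link (line D) φ (Owned p q) (φ p) (φ q)
        link {zero}  {suc i} _ = spoke i
        link {suc i} {suc j} (s≤s i<j) = edgeLink (line D)
          (proj₁ (star⁻ {D} (end∈ i)) , proj₁ (star⁻ {D} (end∈ j)) , (Fin.<⇒≢ i<j ∘ end-injective) ,
           y , proj₂ (star⁻ {D} (end∈ i)) , proj₂ (star⁻ {D} (end∈ j)))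
          straight

    critical-immersion : ∀ {e} → e ∈ˢ D →
                         ContainsTotallyOddStrongImmersion (line D) (complete (suc d))
    critical-immersion {e} e∈ with Fin.any? (λ b → b ∈ˢ? D ×-dec length (neighbours b) ℕ.≤? d)
    ... | yes (b , b∈ , few) = few-neighbours b∈ few
    ... | no ¬few =
      let _ , _ , x≢y , _ , _ , L  = linked-stars critical e∈
          _ , f∈ , f≢e , u∈f , _   = full-neighbour critical e∈ (inj₁ refl)
          -- The edge `e` and the one found by `full-neighbour` share an end, which gives the bound
          -- 2 ≤ d that `centre` requires.
          2≤degree = unique-⊆-length ((f≢e ∷ []) ∷ [] ∷ []) λ
            { (here refl) → star⁺ f∈ u∈f ; (there (here refl)) → star⁺ e∈ (inj₁ refl) }
      in Spokes.spokes-immersion (λ b∈ → ℕ.≰⇒> λ few → ¬few (_ , b∈ , few)) x≢y L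
           (ℕ.≤-trans 2≤degree (degree≤ (proj₁ (ends e))))

-- Parallel edges

module _ {A : Set} {R : Rel A 0ℓ} where

  data Position : ∀ {u v} → Star R u v → A → Parity → Set where
    here  : ∀ {u v} {w : Star R u v} → Position w u 0ℙ
    there : ∀ {u t v x π} {r : R u t} {w : Star R t v} → Position w x π → Position (r ◅ w) x (π ⁻¹)

  position-support : ∀ {u v x π} {w : Star R u v} → Position w x π → x ∈ support w
  position-support {w = w} here = start∈support w
  position-support (there p)    = there (position-support p)

  position-unique : ∀ {u v x π ρ} {w : Star R u v} → Unique (support w) →
                    Position w x π → Position w x ρ → π ≡ ρ
  position-unique U       here      here      = refl
  position-unique U       here      (there q) = contradiction (position-support q) (unique-head U)
  position-unique U       (there p) here      = contradiction (position-support p) (unique-head U)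
  position-unique (_ ∷ U) (there p) (there q) = cong _⁻¹ (position-unique U p q)

  position-end : ∀ {u v} (w : Star R u v) → Position w v (parity (length (arcs w)))
  position-end ε       = here
  position-end (r ◅ w) =
    subst (Position (r ◅ w) _) (sym (parity-suc (length (arcs w)))) (there (position-end w))

choose : ∀ {A : Set} → Parity → A → A → A
choose 0ℙ a b = a
choose 1ℙ a b = b

choose-flip : ∀ {A : Set} π {a b : A} → choose (π ⁻¹) a b ≡ choose π b a
choose-flip 0ℙ = refl
choose-flip 1ℙ = refl

choose-injective : ∀ {A : Set} π {a b a′ b′ : A} → choose π a b ≡ choose π a′ b′ →
                   choose (π ⁻¹) a b ≡ choose (π ⁻¹) a′ b′ → a ≡ a′ × b ≡ b′
choose-injective 0ℙ e e′ = e , e′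
choose-injective 1ℙ e e′ = e′ , e

module BlowUp (H : Multigraph) {m : ℕ} (1≤m : 1 ℕ.≤ m)
              (mult : ∀ u v → Multigraph.Adjacent H u v → Multigraph.multiplicity H u v ≡ m) where
  open Multigraph H
  open Line H

  copies : E → List E
  copies e = filter (joins? (proj₁ (ends e)) (proj₂ (ends e))) (allFin size)

  copies-length : ∀ e → m ≡ length (copies e)
  copies-length e = sym (mult _ _ (e , inj₁ refl))

  copies-unique : ∀ e → Unique (copies e)
  copies-unique e = Unique.filter⁺ (joins? (proj₁ (ends e)) (proj₂ (ends e))) (Unique.allFin⁺ size)

  copies-self : ∀ e → e ∈ copies e
  copies-self e = ∈-filter⁺ (joins? (proj₁ (ends e)) (proj₂ (ends e))) (∈-allFin e) (inj₁ refl)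

  -- All members of a parallel class have the same list of copies, in the same order and whichever
  -- way their ends are stored. So `copies e` is a canonical name of the class.
  joins-copies : ∀ {t s e} → Joins t s e → copies e ≡ filter (joins? t s) (allFin size)
  joins-copies {t} {s} {e} (inj₁ eq) =
    cong (λ (a , b) → filter (joins? a b) (allFin size)) eq
  joins-copies {t} {s} {e} (inj₂ eq) =
    trans (cong (λ (a , b) → filter (joins? a b) (allFin size)) eq)
          (List.filter-≐ (joins? s t) (joins? t s) (joins-sym , joins-sym) (allFin size))

  copies-joins : ∀ {e f} → f ∈ copies e → Joins (proj₁ (ends e)) (proj₂ (ends e)) f
  copies-joins {e} f∈ =
    proj₂ (∈-filter⁻ (joins? (proj₁ (ends e)) (proj₂ (ends e))) {xs = allFin size} f∈)

  ∈-copies : ∀ {e f} → f ∈ copies e → copies f ≡ copies e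
  ∈-copies f∈ = joins-copies (copies-joins f∈)

  ∈-copies-incident : ∀ {e f t} → f ∈ copies e → Incident t e → Incident t f
  ∈-copies-incident f∈ (inj₁ refl) = joins-incident (copies-joins f∈)
  ∈-copies-incident f∈ (inj₂ refl) = joins-incident (joins-sym (copies-joins f∈))

  nth : (es : List E) → .(m ≡ length es) → Fin m → E
  nth es eq i = lookup es (Fin.cast eq i)

  copy : E → Fin m → E
  copy e = nth (copies e) (copies-length e)

  copy∈ : ∀ e i → copy e i ∈ copies e
  copy∈ e i = ∈-lookup (Fin.cast (copies-length e) i)

  copy-cong : ∀ {e f} i → copies e ≡ copies f → copy e i ≡ copy f i
  copy-cong {e} {f} i eq = nth-cong (copies-length e) (copies-length f) eq
    where
    nth-cong : ∀ {es fs} .(p : m ≡ length es) .(q : m ≡ length fs) → es ≡ fs → nth es p i ≡ nth fs q i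
    nth-cong p q refl = refl

  copy-injective : ∀ e {i j} → copy e i ≡ copy e j → i ≡ j
  copy-injective e {i} {j} eq = Fin.toℕ-injective (trans (sym (Fin.toℕ-cast _ i))
    (trans (cong Fin.toℕ (lookup-unique (copies-unique e) eq)) (Fin.toℕ-cast _ j)))

  rank : E → Fin m
  rank e = Fin.cast (sym (copies-length e)) (Any.index (copies-self e))

  copy-rank : ∀ e → copy e (rank e) ≡ e
  copy-rank e = trans
    (cong (lookup (copies e)) (Fin.cast-involutive (copies-length e) (sym (copies-length e)) _))
    (sym (Any.lookup-index (copies-self e)))

  -- `1≤m` reads 0 < m, so this is the copy of index 0.
  representative : E → E
  representative e = copy e (Fin.fromℕ< 1≤m)

  copies-representative : ∀ e → copies (representative e) ≡ copies e
  copies-representative e = ∈-copies (copy∈ e (Fin.fromℕ< 1≤m))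

  isRepresentative? : ∀ e → Dec (representative e ≡ e)
  isRepresentative? e = representative e Fin.≟ e

  D₀ : Subset size
  D₀ = subset isRepresentative?

  representative∈ : ∀ e → representative e ∈ˢ D₀
  representative∈ e = subset⁺ isRepresentative? (copy-cong (Fin.fromℕ< 1≤m) (copies-representative e))

  same-copies : ∀ {e f} → e ∈ˢ D₀ → f ∈ˢ D₀ → copies e ≡ copies f → e ≡ f
  same-copies e∈ f∈ eq = trans (sym (subset⁻ isRepresentative? e∈))
    (trans (copy-cong (Fin.fromℕ< 1≤m) eq) (subset⁻ isRepresentative? f∈))

  D₀-simple : SimpleOn D₀
  D₀-simple e∈ f∈ j j′ = same-copies e∈ f∈ (trans (joins-copies j) (sym (joins-copies j′)))

  blow-colourable : ∀ {t} → Colourable (line D₀) t → Colourable (lineGraph H) (t ℕ.* m)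
  blow-colourable {t} (c , proper) = c′ , proper′
    where
    c′ : E → Fin (t ℕ.* m)
    c′ e = Fin.combine (c (representative e)) (rank e)
    proper′ : IsColouring (lineGraph H) c′
    proper′ e f (e≢f , v , v∈e , v∈f) eq
      with Fin.combine-injective (c (representative e)) (rank e) (c (representative f)) (rank f) eq
    ... | ce≡cf , re≡rf with representative e Fin.≟ representative f
    ... | yes same = e≢f (trans (sym (copy-rank e)) (trans (cong (copy e) re≡rf)
          (trans (copy-cong (rank f) copies≡) (copy-rank f))))
      where
      copies≡ : copies e ≡ copies f
      copies≡ = trans (sym (copies-representative e))
        (trans (cong copies same) (copies-representative f))
    ... | no ¬same = proper _ _
      (representative∈ e , representative∈ f , ¬same , v ,
       ∈-copies-incident (copy∈ e _) v∈e , ∈-copies-incident (copy∈ f _) v∈f) ce≡cf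

  module Lift {D : Subset size} (D⊆D₀ : D ⊆ˢ D₀) where
    open Graph (line D) using (Adj; adj-irrefl)
    module L = Graph (lineGraph H)

    copies-injective : ∀ {x y i j} → x ∈ˢ D → y ∈ˢ D → copies (copy x i) ≡ copies (copy y j) → x ≡ y
    copies-injective {x} {y} {i} {j} x∈ y∈ eq = same-copies (D⊆D₀ x∈) (D⊆D₀ y∈)
      (trans (sym (∈-copies (copy∈ x i))) (trans eq (∈-copies (copy∈ y j))))

    copy-adj : ∀ {x y} i j → Adj x y → L.Adj (copy x i) (copy y j)
    copy-adj {x} {y} i j xy@(x∈ , y∈ , x≢y , v , v∈x , v∈y) =
      (λ eq → x≢y (copies-injective x∈ y∈ (cong copies eq))) ,
      v , ∈-copies-incident (copy∈ x i) v∈x , ∈-copies-incident (copy∈ y j) v∈y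

    -- The levels change places at every step, so the walk ends at level `a` or `b` according to its
    -- parity.
    lift : ∀ {u v} (w : Star Adj u v) π a b → parity (length (arcs w)) ≡ π →
           Star L.Adj (copy u a) (copy v (choose π a b))
    lift ε       0ℙ a b _  = ε
    lift (r ◅ w) 0ℙ a b eq = copy-adj a b r ◅ lift w 1ℙ b a
      (Parity.⁻¹-injective (trans (sym (parity-suc (length (arcs w)))) eq))
    lift (r ◅ w) 1ℙ a b eq = copy-adj a b r ◅ lift w 0ℙ b a
      (Parity.⁻¹-injective (trans (sym (parity-suc (length (arcs w)))) eq))

    lift-length : ∀ {u v} (w : Star Adj u v) π a b eq →
                  length (arcs (lift w π a b eq)) ≡ length (arcs w)
    lift-length ε       0ℙ a b eq = refl
    lift-length (r ◅ w) 0ℙ a b eq = cong suc (lift-length w 1ℙ b a _)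
    lift-length (r ◅ w) 1ℙ a b eq = cong suc (lift-length w 0ℙ b a _)

    lift-support : ∀ {u v} (w : Star Adj u v) π a b eq {z} → z ∈ support (lift w π a b eq) →
                   ∃₂ λ x ρ → Position w x ρ × z ≡ copy x (choose ρ a b)
    lift-support ε       0ℙ a b eq (here refl) = _ , 0ℙ , here , refl
    lift-support (r ◅ w) 0ℙ a b eq (here refl) = _ , 0ℙ , here , refl
    lift-support (r ◅ w) 1ℙ a b eq (here refl) = _ , 0ℙ , here , refl
    lift-support (r ◅ w) 0ℙ a b eq (there z∈) =
      let x , ρ , p , z≡ = lift-support w 1ℙ b a _ z∈
      in x , ρ ⁻¹ , there p , trans z≡ (cong (copy x) (sym (choose-flip ρ)))
    lift-support (r ◅ w) 1ℙ a b eq (there z∈) =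
      let x , ρ , p , z≡ = lift-support w 0ℙ b a _ z∈
      in x , ρ ⁻¹ , there p , trans z≡ (cong (copy x) (sym (choose-flip ρ)))

    record Lifted {u v} (w : Star Adj u v) (a b : Fin m) (z z′ : E) : Set where
      field
        {x y} : E
        {ρ}   : Parity
        arc   : (x , y) ∈ arcs w
        at-x  : Position w x ρ
        at-y  : Position w y (ρ ⁻¹)
        z≡    : z ≡ copy x (choose ρ a b)
        z′≡   : z′ ≡ copy y (choose (ρ ⁻¹) a b)

    lifted-there : ∀ {u t v} {r : Adj u t} {w : Star Adj t v} {a b z z′} →
                   Lifted w b a z z′ → Lifted (r ◅ w) a b z z′
    lifted-there l = record
      { arc = there arc ; at-x = there at-x ; at-y = there at-y
      ; z≡  = trans z≡ (cong (copy x) (sym (choose-flip ρ)))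
      ; z′≡ = trans z′≡ (cong (copy y) (sym (choose-flip (ρ ⁻¹))))
      }
      where open Lifted l

    lift-arcs : ∀ {u v} (w : Star Adj u v) π a b eq {z z′} → (z , z′) ∈ arcs (lift w π a b eq) →
                Lifted w a b z z′
    lift-arcs ε       0ℙ a b eq ()
    lift-arcs (r ◅ w) 0ℙ a b eq (here refl) = record
      { arc = here refl ; at-x = here ; at-y = there here ; z≡ = refl ; z′≡ = refl }
    lift-arcs (r ◅ w) 1ℙ a b eq (here refl) = record
      { arc = here refl ; at-x = here ; at-y = there here ; z≡ = refl ; z′≡ = refl }
    lift-arcs (r ◅ w) 0ℙ a b eq (there zz′∈) = lifted-there (lift-arcs w 1ℙ b a _ zz′∈)
    lift-arcs (r ◅ w) 1ℙ a b eq (there zz′∈) = lifted-there (lift-arcs w 0ℙ b a _ zz′∈)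

    support-from : ∀ {u v} (w : Star Adj u v) → u ∈ˢ D → ∀ {x} → x ∈ support w → x ∈ˢ D
    support-from ε u∈ (here refl) = u∈
    support-from (_ ◅ _) u∈ (here refl) = u∈
    support-from ((_ , t∈ , _) ◅ w) _ (there x∈) = support-from w t∈ x∈

    -- An edge outside `D` is isolated in `line D`, so only a trivial walk can contain it.
    support-inside : ∀ {u v} (w : Star Adj u v) → u ≢ v → ∀ {x} → x ∈ support w → x ∈ˢ D
    support-inside ε u≢u = contradiction refl u≢u
    support-inside w@((u∈ , _) ◅ _) _ = support-from w u∈

    Inside : ∀ {u v} → Star Adj u v → Set
    Inside w = ∀ {x} → x ∈ support w → x ∈ˢ D

    copy-fresh : ∀ {t u v} (w : Star Adj u v) → Inside w → t ∈ˢ D → t ∉ support w →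
                 ∀ π a b eq i → copy t i ∉ support (lift w π a b eq)
    copy-fresh w inside t∈ t∉ π a b eq i ti∈ =
      let _ , _ , at , e = lift-support w π a b eq ti∈
          x∈w            = position-support at
      in t∉ (subst (_∈ support w) (sym (copies-injective t∈ (inside x∈w) (cong copies e))) x∈w)

    lift-unique : ∀ {u v} (w : Star Adj u v) π a b eq → Inside w →
                  Unique (support w) → Unique (support (lift w π a b eq))
    lift-unique ε       0ℙ a b eq inside U = [] ∷ []
    lift-unique (r ◅ w) 0ℙ a b eq inside U@(_ ∷ U′) =
      ∉⇒All≢ (copy-fresh w (inside ∘ there) (inside (here refl)) (unique-head U) 1ℙ b a _ a)
      ∷ lift-unique w 1ℙ b a _ (inside ∘ there) U′
    lift-unique (r ◅ w) 1ℙ a b eq inside U@(_ ∷ U′) =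
      ∉⇒All≢ (copy-fresh w (inside ∘ there) (inside (here refl)) (unique-head U) 0ℙ b a _ a)
      ∷ lift-unique w 0ℙ b a _ (inside ∘ there) U′

    position-match : ∀ {u v u′ v′ x y π ρ i j z} {w : Star Adj u v} {w′ : Star Adj u′ v′} →
                     Inside w → Inside w′ → Position w x π → Position w′ y ρ →
                     z ≡ copy x i → z ≡ copy y j → x ≡ y
    position-match inside inside′ at at′ e e′ =
      copies-injective (inside (position-support at)) (inside′ (position-support at′))
        (cong copies (trans (sym e) e′))

    Lifted± : ∀ {u v} → Star Adj u v → Fin m → Fin m → E → E → Set
    Lifted± w a b z z′ = Lifted w a b z z′ ⊎ Lifted w a b z′ z

    -- Along an odd path u = x₀ , … , x₂ₖ₊₁ = v the copies a and b alternate.  A step between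
    -- copies of xᵢ and xᵢ₊₁ then determines a and b, so the m² lifts are edge-disjoint.
    module _ {t s : ℕ} (immersed : ContainsTotallyOddStrongImmersion (line D) (complete t))
             (s≤tm : s ℕ.≤ t ℕ.* m) where
      private
        I      = proj₁ immersed
        strong = proj₁ (proj₂ immersed)
        odd    = proj₂ (proj₂ immersed)
      open Immersion I using (φ; φ-injective; path; edge-disjoint)

      link : ∀ {p q : Fin t} → p Fin.< q → Graph.Edge (complete t)
      link {p} {q} p<q = Graph.edge p q p<q (Fin.<⇒≢ p<q)

      route : ∀ {p q} → p Fin.< q → Star Adj (φ p) (φ q)
      route p<q = Path.walk (path (link p<q))

      route-unique : ∀ {p q} (p<q : p Fin.< q) → Unique (support (route p<q))
      route-unique p<q =
        subst Unique (vertices≡support (line D) (route p<q)) (Path.distinct (path (link p<q)))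

      route-odd : ∀ {p q} (p<q : p Fin.< q) → parity (length (arcs (route p<q))) ≡ 1ℙ
      route-odd p<q =
        trans (cong (parity ∘ length) (sym (steps≡arcs (line D) (route p<q)))) (odd (link p<q))

      route-inside : ∀ {p q} (p<q : p Fin.< q) → Inside (route p<q)
      route-inside p<q = support-inside (route p<q) (Fin.<⇒≢ p<q ∘ φ-injective)

      ArcOf : ∀ {p q} → p Fin.< q → E → E → Set
      ArcOf p<q x y = (x , y) ∈ arcs (route p<q) ⊎ (y , x) ∈ arcs (route p<q)

      traversed : ∀ {p q} (p<q : p Fin.< q) {x y} → ArcOf p<q x y →
                  Path.Traverses (path (link p<q)) (x , y)
      traversed p<q (inj₁ xy∈) = inj₁ (subst (_ ∈_) (sym (steps≡arcs (line D) (route p<q))) xy∈)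
      traversed p<q (inj₂ yx∈) = inj₂ (subst (_ ∈_) (sym (steps≡arcs (line D) (route p<q))) yx∈)

      same-route : ∀ {p q p′ q′} (p<q : p Fin.< q) (p′<q′ : p′ Fin.< q′) {x y} →
                   ArcOf p<q x y → ArcOf p′<q′ x y → p ≡ p′ × q ≡ q′
      same-route {p} {q} {p′} {q′} p<q p′<q′ xy∈ xy∈′ with p Fin.≟ p′ | q Fin.≟ q′
      ... | yes p≡ | yes q≡ = p≡ , q≡
      ... | no  p≢ | _ = ⊥-elim (edge-disjoint (link p<q) (link p′<q′) (λ { refl → p≢ refl }) _
                                   (traversed p<q xy∈ , traversed p′<q′ xy∈′))
      ... | yes _ | no q≢ = ⊥-elim (edge-disjoint (link p<q) (link p′<q′) (λ { refl → q≢ refl }) _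
                                   (traversed p<q xy∈ , traversed p′<q′ xy∈′))

      -- A terminal is known to be in `D` only through a route at it, hence the second terminal `q`.
      terminal-inside : ∀ {p q} → p ≢ q → φ p ∈ˢ D
      terminal-inside {p} {q} p≢q with Fin.<-cmp p q
      ... | tri< p<q _ _ = route-inside p<q (start∈support (route p<q))
      ... | tri≈ _ p≡q _ = contradiction p≡q p≢q
      ... | tri> _ _ q<p = route-inside q<p (end∈support (route q<p))

      base : Fin s → Fin t
      base P = proj₁ (Fin.remQuot {t} m (Fin.inject≤ P s≤tm))

      level : Fin s → Fin m
      level P = proj₂ (Fin.remQuot {t} m (Fin.inject≤ P s≤tm))

      combine-base-level : ∀ P → Fin.combine (base P) (level P) ≡ Fin.inject≤ P s≤tm
      combine-base-level P = Fin.combine-remQuot {t} m (Fin.inject≤ P s≤tm)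

      base-level-injective : ∀ {P Q} → base P ≡ base Q → level P ≡ level Q → P ≡ Q
      base-level-injective {P} {Q} e e′ = Fin.inject≤-injective s≤tm s≤tm P Q
        (trans (sym (combine-base-level P)) (trans (cong₂ Fin.combine e e′) (combine-base-level Q)))

      -- The numbering of the copies is lexicographic, so routes are only ever lifted in their own
      -- direction.
      base-monotone : ∀ {P Q} → P Fin.< Q → ¬ base Q Fin.< base P
      base-monotone {P} {Q} P<Q q<p = ℕ.<-asym P<Q
        (subst₂ ℕ._<_ (Fin.toℕ-inject≤ Q s≤tm) (Fin.toℕ-inject≤ P s≤tm)
          (subst₂ Fin._<_ (combine-base-level Q) (combine-base-level P)
            (Fin.combine-monoˡ-< (level Q) (level P) q<p)))

      Φ : Fin s → E
      Φ P = copy (φ (base P)) (level P)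

      Φ-injective : Injective _≡_ _≡_ Φ
      Φ-injective {P} {Q} eq with base P Fin.≟ base Q
      ... | yes p≡q = base-level-injective p≡q
        (copy-injective (φ (base P)) (trans eq (cong (λ p → copy (φ p) (level Q)) (sym p≡q))))
      ... | no  p≢q = contradiction (φ-injective (copies-injective (terminal-inside p≢q)
                        (terminal-inside (p≢q ∘ sym)) (cong copies eq))) p≢q

      Crossing : Fin s → Fin s → E → E → Set
      Crossing P Q z z′ = Σ (base P Fin.< base Q) λ p<q →
        Lifted± (route p<q) (level P) (level Q) z z′

      Own : Fin s → Fin s → E → E → Set
      Own P Q z z′ = (base P ≡ base Q × Pair Φ P Q z z′) ⊎ Crossing P Q z z′

      own-sym : ∀ {P Q z z′} → Own P Q z z′ → Own P Q z′ z
      own-sym (inj₁ (eq , pair))        = inj₁ (eq , pair-sym pair)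
      own-sym (inj₂ (p<q , inj₁ lifted)) = inj₂ (p<q , inj₂ lifted)
      own-sym (inj₂ (p<q , inj₂ lifted)) = inj₂ (p<q , inj₁ lifted)

      -- A reserved direct edge joins two parallel edges of `H`, whereas a lifted step joins copies
      -- of two different edges of `D`.
      pair-not-lifted : ∀ {P Q z z′ p q a b} (p<q : p Fin.< q) → base P ≡ base Q → Pair Φ P Q z z′ →
                        ¬ Lifted (route p<q) a b z z′
      pair-not-lifted {P} {Q} {z} {z′} p<q eq pair l =
        adj-irrefl
          (copies-injective (route-inside p<q (position-support at-x))
                            (route-inside p<q (position-support at-y))
            (trans (cong copies (sym z≡)) (trans (parallel pair) (cong copies z′≡))))
          (arcs-related (route p<q) arc)
        where
        open Lifted l
        copies-Φ : ∀ P → copies (Φ P) ≡ copies (φ (base P))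
        copies-Φ P = ∈-copies (copy∈ _ (level P))
        parallel : ∀ {z z′} → Pair Φ P Q z z′ → copies z ≡ copies z′
        parallel straight = trans (copies-Φ P) (trans (cong (copies ∘ φ) eq) (sym (copies-Φ Q)))
        parallel reversed = trans (copies-Φ Q) (trans (cong (copies ∘ φ) (sym eq)) (sym (copies-Φ P)))

      lifted-levels : ∀ {u v} (w : Star Adj u v) → Unique (support w) → Inside w →
        ∀ {a b a′ b′ z z′} → Lifted w a b z z′ → Lifted± w a′ b′ z z′ → a ≡ a′ × b ≡ b′
      lifted-levels w U inside {a} {b} {a′} {b′} l (inj₁ l′) =
        by (position-match inside inside M.at-x M′.at-x M.z≡ M′.z≡)
           (position-match inside inside M.at-y M′.at-y M.z′≡ M′.z′≡)
        where
        module M = Lifted l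
        module M′ = Lifted l′
        by : M.x ≡ M′.x → M.y ≡ M′.y → a ≡ a′ × b ≡ b′
        by refl refl with refl ← position-unique U M.at-x M′.at-x = choose-injective M.ρ
          (copy-injective M.x (trans (sym M.z≡) M′.z≡))
          (copy-injective M.y (trans (sym M.z′≡) M′.z′≡))
      lifted-levels w U inside {a} {b} {a′} {b′} l (inj₂ l′) =
        by (position-match inside inside M.at-x M′.at-y M.z≡ M′.z′≡)
           (position-match inside inside M.at-y M′.at-x M.z′≡ M′.z≡)
        where
        module M = Lifted l
        module M′ = Lifted l′
        by : M.x ≡ M′.y → M.y ≡ M′.x → a ≡ a′ × b ≡ b′
        by refl refl = choose-injective M.ρ
          (copy-injective M.x (trans (sym M.z≡) (subst (λ π → _ ≡ copy M.x (choose π a′ b′))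
            (position-unique U M′.at-y M.at-x) M′.z′≡)))
          (copy-injective M.y (trans (sym M.z′≡) (subst (λ π → _ ≡ copy M.y (choose π a′ b′))
            (position-unique U M′.at-x M.at-y) M′.z≡)))

      lifted-flip : ∀ {u v} {w : Star Adj u v} {a b z z′} → Lifted± w a b z z′ → Lifted± w a b z′ z
      lifted-flip (inj₁ l) = inj₂ l
      lifted-flip (inj₂ l) = inj₁ l

      crossing-unique : ∀ {P Q P′ Q′ z z′} → Crossing P Q z z′ → Crossing P′ Q′ z z′ →
                        P ≡ P′ × Q ≡ Q′
      crossing-unique (p<q , inj₂ l) (p′<q′ , l′) =
        crossing-unique (p<q , inj₁ l) (p′<q′ , lifted-flip l′)
      crossing-unique {P} {Q} {P′} {Q′} (p<q , inj₁ l) (p′<q′ , l′) =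
        let p≡ , q≡ = same-route p<q p′<q′ (inj₁ (Lifted.arc l)) (arc-of l′)
            a≡ , b≡ = lifted-levels (route p<q) (route-unique p<q) (route-inside p<q) l
                        (transport p≡ q≡ p<q p′<q′ l′)
        in base-level-injective p≡ a≡ , base-level-injective q≡ b≡
        where
        module M = Lifted l
        match : ∀ {x y π ρ i j z} → Position (route p′<q′) x π → Position (route p<q) y ρ →
                z ≡ copy x i → z ≡ copy y j → x ≡ y
        match = position-match (route-inside p′<q′) (route-inside p<q)
        arc-of : Lifted± (route p′<q′) (level P′) (level Q′) _ _ → ArcOf p′<q′ M.x M.y
        arc-of (inj₁ k) = inj₁ (subst₂ (λ x y → (x , y) ∈ arcs (route p′<q′))
          (match (Lifted.at-x k) M.at-x (Lifted.z≡ k) M.z≡)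
          (match (Lifted.at-y k) M.at-y (Lifted.z′≡ k) M.z′≡) (Lifted.arc k))
        arc-of (inj₂ k) = inj₂ (subst₂ (λ x y → (x , y) ∈ arcs (route p′<q′))
          (match (Lifted.at-x k) M.at-y (Lifted.z≡ k) M.z′≡)
          (match (Lifted.at-y k) M.at-x (Lifted.z′≡ k) M.z≡) (Lifted.arc k))
        transport : ∀ {p q p′ q′} → p ≡ p′ → q ≡ q′ → (p<q : p Fin.< q) (p′<q′ : p′ Fin.< q′) →
                    ∀ {a b z z′} → Lifted± (route p′<q′) a b z z′ → Lifted± (route p<q) a b z z′
        transport refl refl _ _ l = l

      own-unique : ∀ {P Q P′ Q′ z z′} → P Fin.< Q → P′ Fin.< Q′ →
                   Own P Q z z′ → Own P′ Q′ z z′ → P ≡ P′ × Q ≡ Q′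
      own-unique P<Q P′<Q′ (inj₁ (_ , o)) (inj₁ (_ , o′)) =
        pair-unique Φ-injective P<Q P′<Q′ o o′ refl refl
      own-unique _ _ (inj₂ c) (inj₂ c′) = crossing-unique c c′
      own-unique _ _ (inj₁ (eq , o)) (inj₂ (p<q , inj₁ l)) = ⊥-elim (pair-not-lifted p<q eq o l)
      own-unique _ _ (inj₁ (eq , o)) (inj₂ (p<q , inj₂ l)) =
        ⊥-elim (pair-not-lifted p<q eq (pair-sym o) l)
      own-unique _ _ (inj₂ (p<q , inj₁ l)) (inj₁ (eq , o)) = ⊥-elim (pair-not-lifted p<q eq o l)
      own-unique _ _ (inj₂ (p<q , inj₂ l)) (inj₁ (eq , o)) =
        ⊥-elim (pair-not-lifted p<q eq (pair-sym o) l)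

      lifted-link : ∀ {P Q} → base P Fin.< base Q → Link (lineGraph H) Φ (Own P Q) (Φ P) (Φ Q)
      lifted-link {P} {Q} p<q = record
        { walk   = walk
        ; simple = lift-unique w 1ℙ a b w-odd (route-inside p<q) (route-unique p<q)
        ; odd    = trans (cong parity (lift-length w 1ℙ a b w-odd)) w-odd
        ; owned  = λ zz′∈ → inj₂ (p<q , inj₁ (lift-arcs w 1ℙ a b w-odd zz′∈))
        ; avoids = avoids
        }
        where
        a = level P
        b = level Q
        w = route p<q
        w-odd = route-odd p<q
        walk = lift w 1ℙ a b w-odd
        p≢q = Fin.<⇒≢ p<q
        inside : ∀ r → φ r ∈ˢ D
        inside r with r Fin.≟ base P
        ... | yes refl = terminal-inside p≢q
        ... | no  r≢p  = terminal-inside r≢p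
        at-end : Position w (φ (base Q)) 1ℙ
        at-end = subst (Position w _) w-odd (position-end w)
        -- `Φ R` lies above `φ (base R)`, which strongness forces to be an end of the route. Its
        -- level is then `a` at the start, where the position is even, and `b` at the end, where it
        -- is odd.
        avoids : ∀ {R} → Φ R ∈ support walk → Φ R ≡ Φ P ⊎ Φ R ≡ Φ Q
        avoids {R} R∈ with lift-support w 1ℙ a b w-odd R∈
        ... | x , ρ , at , eq
            with copies-injective (inside (base R)) (route-inside p<q (position-support at))
                   (cong copies eq)
        ... | refl with base R Fin.≟ base P | base R Fin.≟ base Q
        ... | yes r≡p | _ with refl ← position-unique (route-unique p<q) at
                                (subst (λ r → Position w (φ r) 0ℙ) (sym r≡p) here) =
          inj₁ (trans eq (cong (λ r → copy (φ r) a) r≡p))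
        ... | no _ | yes r≡q with refl ← position-unique (route-unique p<q) at
                                (subst (λ r → Position w (φ r) 1ℙ) (sym r≡q) at-end) =
          inj₂ (trans eq (cong (λ r → copy (φ r) b) r≡q))
        ... | no r≢p | no r≢q = ⊥-elim (strong (base R) (link p<q)
          (subst (_ ∈_) (sym (vertices≡support (line D) w)) (position-support at) ,
           (r≢p ∘ φ-injective) , (r≢q ∘ φ-injective)))

      blown-immersion : ContainsTotallyOddStrongImmersion (lineGraph H) (complete s)
      blown-immersion = immersion (lineGraph H) Φ Φ-injective Own own-sym own-unique links
        where
        links : ∀ {P Q} → P Fin.< Q → Link (lineGraph H) Φ (Own P Q) (Φ P) (Φ Q)
        links {P} {Q} P<Q with Fin.<-cmp (base P) (base Q)
        ... | tri< p<q _ _ = lifted-link p<q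
        ... | tri> _ _ q<p = contradiction q<p (base-monotone P<Q)
        ... | tri≈ _ p≡q _ = edgeLink (lineGraph H)
          ((Fin.<⇒≢ P<Q ∘ Φ-injective) , _ ,
           ∈-copies-incident (copy∈ (φ (base P)) (level P)) (inj₁ refl) ,
           ∈-copies-incident (copy∈ (φ (base Q)) (level Q)) (inj₁ (cong (proj₁ ∘ ends ∘ φ) p≡q)))
          (inj₁ (p≡q , straight))

-- The simple case and the conclusion

module BaseImmersion (H : Multigraph) where
  open Multigraph H
  open Line H
  open Criticality H
  open CriticalImmersion H

  star-immersion : ∀ {D t} v → t ℕ.≤ degree D v →
                   ContainsTotallyOddStrongImmersion (line D) (complete t)
  star-immersion {D} v t≤ = clique-immersion (line D) (star D v) (star-unique D v) t≤ λ e∈ f∈ e≢f →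
    let e∈D , v∈e = star⁻ {D} e∈
        f∈D , v∈f = star⁻ {D} f∈
    in e∈D , f∈D , e≢f , v , v∈e , v∈f

  single-immersion : ∀ {D} → E → ContainsTotallyOddStrongImmersion (line D) (complete 1)
  single-immersion {D} e = clique-immersion (line D) (e ∷ []) ([] ∷ []) ℕ.≤-refl
    λ { (here refl) (here refl) e≢e → contradiction refl e≢e }

  nonempty : ∀ {D d} → ¬ Colourable (line D) (suc d) → ∃ λ e → e ∈ˢ D
  nonempty {D} ¬col with Fin.any? (_∈ˢ? D)
  ... | yes found = found
  ... | no ¬found = contradiction ((λ _ → zero) , λ e _ (e∈ , _) → contradiction (e , e∈) ¬found) ¬col

  base-immersion : ∀ {D t} → SimpleOn D → (∀ j → Colourable (line D) j → t ℕ.≤ j) →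
    ∃ λ D′ → D′ ⊆ˢ D × ContainsTotallyOddStrongImmersion (line D′) (complete t)
  base-immersion {D} {zero} _ _ = D , id , clique-immersion (line D) [] [] z≤n λ ()
  base-immersion {D} {suc d} simple min with Fin.any? (λ v → suc d ℕ.≤? degree D v)
  ... | yes (v , large) = D , id , star-immersion v large
  -- This case is separate because edges outside `D` are vertices of `line D` as well: that no
  -- colouring with 0 colours exists does not make `D` nonempty.
  base-immersion {D} {suc zero} simple min | no _ with Fin.any? {n = size} (λ _ → yes tt)
  ... | yes (e , _) = D , id , single-immersion e
  ... | no ¬e = contradiction (min 0 ((λ e → absurd e) , λ e → absurd e)) λ ()
    where
    absurd : ∀ {A : Set} → E → A
    absurd e = contradiction (e , tt) ¬e
  base-immersion {D} {suc (suc d)} simple min | no small =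
    let D′ , D′⊆D , critical = critical-subset simple (λ v → ℕ.≮⇒≥ λ large → small (v , large))
                                 λ col → contradiction (min (suc d) col) ℕ.1+n≰n
        _ , e∈ = nonempty (IsCritical.¬colourable critical)
    in D′ , D′⊆D , critical-immersion critical e∈

theorem3 : (H : Multigraph) → ConstantMultiplicity H →
    let G = lineGraph H in
    ContainsTotallyOddStrongImmersion G (complete (χ G))
theorem3 H (m , 1≤m , mult) =
  let t , colouring , minimal  = chromaticNumber (line D₀)
      D , D⊆D₀ , immersed      = base-immersion D₀-simple minimal
  in Lift.blown-immersion D⊆D₀ immersed
       (proj₂ (proj₂ (chromaticNumber (lineGraph H))) (t ℕ.* m) (blow-colourable colouring))
  where
  open Line H
  open BlowUp H 1≤m mult
  open BaseImmersion H
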